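{- The set of well-formed sentences of finitary hybrid $\mathsf{CTL}^{*}_{lp}$ has the same expressiveness as finitary $\mathsf{CTL}^{*}$: every such sentence has the same finite Kripke structures as models as some finitary $\mathsf{CTL}^{*}$ formula, and vice versa.
   Context: A Kripke structure is $K=(\mathcal{AP},S,\delta,\mu,s_0)$ ($\mathcal{AP}$ finite, left-total $\delta$, $\mu:S\to2^{\mathcal{AP}}$, initial $s_0$); finite if $S$ finite. A trace is a non-empty finite sequence of states following $\delta$, initial if it starts at $s_0$. Finitary $\mathsf{CTL}^*$: $\varphi::=\top\mid p\mid\neg\varphi\mid\varphi\wedge\varphi\mid\mathsf{X}\varphi\mid\varphi\,\mathsf{U}\,\varphi\mid\exists_f\varphi$ interpreted at positions $i<|\rho|$ of traces: $\mathsf{X}\varphi$ iff $i+1<|\rho|$ and $\varphi$ at $i+1$; $\varphi_1\mathsf{U}\varphi_2$ iff for some $i\le j<|\rho|$, $\varphi_2$ at $j$ and $\varphi_1$ on $[i,j)$; $\exists_f\varphi$ iff some trace $\rho'$ starting at $\rho(i)$ has $\rho',0\models\varphi$. $K$ is a model iff all initial traces satisfy $\varphi$ at $0$. Finitary hybrid $\mathsf{CTL}^*_{lp}$: $\varphi::=\top\mid p\mid x\mid\neg\varphi\mid\varphi\vee\varphi\mid{\downarrow}x.\varphi\mid\mathsf{X}\varphi\mid\varphi\,\mathsf{U}\,\varphi\mid\mathsf{X}^{ - }\varphi\mid\varphi\,\mathsf{U}^{ - }\varphi\mid\exists_f\varphi$ ($x$ position variables), $\mathsf{F}^-\varphi:=\top\mathsf{U}^-\varphi$,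 interpreted on initial traces $\rho$, valuations $g$, positions $i<|\rho|$: $x$ iff $g(x)=i$; ${\downarrow}x.\varphi$ iff $\rho,g[x\leftarrow i],i\models\varphi$; $\mathsf{X},\mathsf{U}$ as in finitary $\mathsf{CTL}^*$; $\mathsf{X}^-\varphi$ iff $i>0$ and $\varphi$ at $i-1$; $\varphi_1\mathsf{U}^-\varphi_2$ iff for some $j\le i$, $\varphi_2$ at $j$ and $\varphi_1$ at all $k\in(j,i]$; $\exists_f\varphi$ iff $\rho',g,i\models\varphi$ for some initial trace $\rho'$ agreeing with $\rho$ on positions $0..i$. $K$ is a model iff all initial traces satisfy the formula at position $0$ with $g_0\equiv0$. A sentence has no free variables; it is well-formed if every subformula $\exists_f\psi$ has at most one free variable and each such subformula with free variable $x$ occurs only in the context $(\mathsf{F}^-x)\wedge\exists_f\psi$. -}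

module Defs where

open import Data.Nat using (ℕ; zero; suc; _≤_; _<_)
open import Data.Nat.Properties using (_≟_)
open import Data.Fin using (Fin; toℕ; inject₁) renaming (zero to fzero; suc to fsuc)
open import Data.Bool using (Bool; true; false)
open import Data.Product using (Σ; Σ-syntax; ∃; _×_; _,_)
open import Data.Sum using (_⊎_)
open import Data.Unit using (⊤)
open import Relation.Nullary using (¬_; yes; no)
open import Relation.Binary.PropositionalEquality using (_≡_; _≢_)
open import Function.Bundles using (_⇔_)

-- Kripke structures over the finite set of atomic propositions AP = Fin k,
-- with finite state set S = Fin n.

record Kripke (k n : ℕ) : Set where
  field
    δ         : Fin n → Fin n → Bool
    leftTotal : (s : Fin n) → Σ[ t ∈ Fin n ] δ s t ≡ true
    μ         : Fin n → Fin k → Bool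
    s₀        : Fin n

record FinKripke (k : ℕ) : Set where
  constructor mkFinKripke
  field
    nStates   : ℕ
    structure : Kripke k nStates

module _ {k n : ℕ} (K : Kripke k n) where
  open Kripke K

  record Trace : Set where
    field
      len : ℕ                                   -- |ρ| = suc len
      st  : Fin (suc len) → Fin n
      ok  : (i : Fin len) → δ (st (inject₁ i)) (st (fsuc i)) ≡ true

  Initial : Trace → Set
  Initial ρ = Trace.st ρ fzero ≡ s₀

  Pos : Trace → Set
  Pos ρ = Fin (suc (Trace.len ρ))

data CForm (k : ℕ) : Set where
  ⊤c   : CForm k
  atom : Fin k → CForm k
  ¬c   : CForm k → CForm k
  _∧c_ : CForm k → CForm k → CForm k
  Xc   : CForm k → CForm k
  _Uc_ : CForm k → CForm k → CForm k
  ∃fc  : CForm k → CForm k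

module _ {k n : ℕ} (K : Kripke k n) where
  open Kripke K

  satC : (ρ : Trace K) → Pos K ρ → CForm k → Set
  satC ρ i ⊤c = ⊤
  satC ρ i (atom p) = Kripke.μ K (Trace.st ρ i) p ≡ true
  satC ρ i (¬c φ) = ¬ satC ρ i φ
  satC ρ i (φ ∧c ψ) = satC ρ i φ × satC ρ i ψ
  satC ρ i (Xc φ) =
    Σ[ j ∈ Pos K ρ ] (toℕ j ≡ suc (toℕ i)) × satC ρ j φ
  satC ρ i (φ Uc ψ) =
    Σ[ j ∈ Pos K ρ ] (toℕ i ≤ toℕ j) × satC ρ j ψ
      × ((l : Pos K ρ) → toℕ i ≤ toℕ l → toℕ l < toℕ j → satC ρ l φ)
  satC ρ i (∃fc φ) =
    Σ[ ρ' ∈ Trace K ] (Trace.st ρ' fzero ≡ Trace.st ρ i) × satC ρ' fzero φ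

  modelC : CForm k → Set
  modelC φ = (ρ : Trace K) → Initial K ρ → satC ρ fzero φ

Var : Set
Var = ℕ

data HForm (k : ℕ) : Set where
  ⊤h   : HForm k
  atom : Fin k → HForm k
  var  : Var → HForm k
  ¬h   : HForm k → HForm k
  _∨h_ : HForm k → HForm k → HForm k
  ↓_·_ : Var → HForm k → HForm k
  Xh   : HForm k → HForm k
  _Uh_ : HForm k → HForm k → HForm k
  X⁻   : HForm k → HForm k
  _U⁻_ : HForm k → HForm k → HForm k
  ∃fh  : HForm k → HForm k

F⁻ : {k : ℕ} → HForm k → HForm k
F⁻ φ = ⊤h U⁻ φ

_∧h_ : {k : ℕ} → HForm k → HForm k → HForm k
φ ∧h ψ = ¬h (¬h φ ∨h ¬h ψ)

Valuation : Set
Valuation = Var → ℕ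

_[_←_] : Valuation → Var → ℕ → Valuation
(g [ x ← v ]) y with y ≟ x
... | yes _ = v
... | no  _ = g y

module _ {k n : ℕ} (K : Kripke k n) where
  open Kripke K

  AgreeUpTo : (ρ ρ' : Trace K) → ℕ → Set
  AgreeUpTo ρ ρ' i =
    (a : Pos K ρ) (b : Pos K ρ') → toℕ a ≡ toℕ b → toℕ a ≤ i →
    Trace.st ρ a ≡ Trace.st ρ' b

  satH : (ρ : Trace K) → Valuation → Pos K ρ → HForm k → Set
  satH ρ g i ⊤h = ⊤
  satH ρ g i (atom p) = μ (Trace.st ρ i) p ≡ true
  satH ρ g i (var x) = g x ≡ toℕ i
  satH ρ g i (¬h φ) = ¬ satH ρ g i φ
  satH ρ g i (φ ∨h ψ) = satH ρ g i φ ⊎ satH ρ g i ψ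
  satH ρ g i (↓ x · φ) = satH ρ (g [ x ← toℕ i ]) i φ
  satH ρ g i (Xh φ) =
    Σ[ j ∈ Pos K ρ ] (toℕ j ≡ suc (toℕ i)) × satH ρ g j φ
  satH ρ g i (φ Uh ψ) =
    Σ[ j ∈ Pos K ρ ] (toℕ i ≤ toℕ j) × satH ρ g j ψ
      × ((l : Pos K ρ) → toℕ i ≤ toℕ l → toℕ l < toℕ j → satH ρ g l φ)
  satH ρ g i (X⁻ φ) =
    Σ[ j ∈ Pos K ρ ] (suc (toℕ j) ≡ toℕ i) × satH ρ g j φ
  satH ρ g i (φ U⁻ ψ) =
    Σ[ j ∈ Pos K ρ ] (toℕ j ≤ toℕ i) × satH ρ g j ψ
      × ((l : Pos K ρ) → toℕ j < toℕ l → toℕ l ≤ toℕ i → satH ρ g l φ)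
  satH ρ g i (∃fh φ) =
    Σ[ ρ' ∈ Trace K ] Initial K ρ' × AgreeUpTo ρ ρ' (toℕ i)
      × (Σ[ i' ∈ Pos K ρ' ] (toℕ i' ≡ toℕ i) × satH ρ' g i' φ)

  g₀ : Valuation
  g₀ _ = 0

  modelH : HForm k → Set
  modelH φ = (ρ : Trace K) → Initial K ρ → satH ρ g₀ fzero φ

data Free {k : ℕ} (x : Var) : HForm k → Set where
  fvar  : Free x (var x)
  f¬    : ∀ {φ} → Free x φ → Free x (¬h φ)
  f∨ˡ   : ∀ {φ ψ} → Free x φ → Free x (φ ∨h ψ)
  f∨ʳ   : ∀ {φ ψ} → Free x ψ → Free x (φ ∨h ψ)
  f↓    : ∀ {y φ} → x ≢ y → Free x φ → Free x (↓ y · φ)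
  fX    : ∀ {φ} → Free x φ → Free x (Xh φ)
  fUˡ   : ∀ {φ ψ} → Free x φ → Free x (φ Uh ψ)
  fUʳ   : ∀ {φ ψ} → Free x ψ → Free x (φ Uh ψ)
  fX⁻   : ∀ {φ} → Free x φ → Free x (X⁻ φ)
  fU⁻ˡ  : ∀ {φ ψ} → Free x φ → Free x (φ U⁻ ψ)
  fU⁻ʳ  : ∀ {φ ψ} → Free x ψ → Free x (φ U⁻ ψ)
  f∃    : ∀ {φ} → Free x φ → Free x (∃fh φ)

Sentence : {k : ℕ} → HForm k → Set
Sentence φ = (x : Var) → ¬ Free x φ

-- Well-formedness: every subformula ∃f ψ has at most one free variable,
-- and if it has a free variable x it occurs only in the context
-- (F⁻ x) ∧ ∃f ψ, where ∧ abbreviates ¬(¬ _ ∨ ¬ _).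
data WF {k : ℕ} : HForm k → Set where
  wf⊤    : WF ⊤h
  wfatom : ∀ {p} → WF (atom p)
  wfvar  : ∀ {x} → WF (var x)
  wf¬    : ∀ {φ} → WF φ → WF (¬h φ)
  wf∨    : ∀ {φ ψ} → WF φ → WF ψ → WF (φ ∨h ψ)
  wf↓    : ∀ {x φ} → WF φ → WF (↓ x · φ)
  wfX    : ∀ {φ} → WF φ → WF (Xh φ)
  wfU    : ∀ {φ ψ} → WF φ → WF ψ → WF (φ Uh ψ)
  wfX⁻   : ∀ {φ} → WF φ → WF (X⁻ φ)
  wfU⁻   : ∀ {φ ψ} → WF φ → WF ψ → WF (φ U⁻ ψ)
  wf∃    : ∀ {ψ} → Sentence ψ → WF ψ → WF (∃fh ψ)
  wfguard : ∀ {x ψ} → ((y : Var) → Free y ψ → y ≡ x) → WF ψ →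
            WF ((F⁻ (var x)) ∧h (∃fh ψ))

WellFormedSentence : {k : ℕ} → HForm k → Set
WellFormedSentence φ = Sentence φ × WF φ

SameFiniteModels : {k : ℕ} → HForm k → CForm k → Set
SameFiniteModels {k} φ ψ =
  (K : FinKripke k) →
  modelH (FinKripke.structure K) φ ⇔ modelC (FinKripke.structure K) ψ

{-# OPTIONS --safe #-}
module Submission where

-- From the hybrid logic to CTL*, every formula is turned, by induction, into a
-- counter-free automaton that reads a trace in which the current position and the
-- values of the variables are marked; its letters are truth values of finitely many
-- CTL* state formulas.  The modalities and ↓ are first-order quantifications over
-- positions, which a subset construction performs without destroying
-- counter-freeness.  A guarded ∃f ψ only has marks in the prefix common to all
-- branches, so it depends on the state q of the automaton of ψ after the prefix and
-- on the existence of a path from the current Kripke state whose unmarked labels are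
-- accepted from q.  By Wilke's induction on states and letters, counter-free
-- automata are LTL-definable, so the latter is a CTL* state formula, which becomes
-- part of the new letters.
-- Constructively, this also decides the hybrid formulas on finite structures, which
-- both directions need, as ∧ in one logic is ¬(¬ ∨ ¬) in the other.

open import Defs
open import Data.Bool using (Bool; true; false; not; _∧_; _∨_; if_then_else_)
open import Data.Bool.Properties using
  (∧-zeroʳ; ∧-identityʳ; ∨-identityʳ; not-involutive)
  renaming (_≟_ to _≟ᵇ_)
open import Data.Empty using (⊥; ⊥-elim)
open import Data.Fin using (Fin; zero; suc; toℕ; fromℕ<; inject₁; punchIn; punchOut; _≟_)
open import Data.Fin.Properties using
  (any?; all?; punchIn-punchOut; punchIn-injective; toℕ-injective; toℕ-fromℕ<; toℕ<n; *↔×; +↔⊎;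
   1↔⊤; 2↔Bool)
open import Data.List as List using (List; []; _∷_; _++_; map; allFin; length)
open import Data.List.Membership.Propositional using (_∈_; _∉_)
open import Data.List.Membership.Propositional.Properties using (∈-map⁺; ∈-allFin)
open import Data.List.Properties using
  (tabulate-lookup; ∷-injectiveˡ; ∷-injectiveʳ; map-++; map-∘; map-id; ++-assoc; length-map;
   length-++; length-tabulate)
open import Data.List.Relation.Unary.All using (All; []; _∷_; universal)
open import Data.List.Relation.Unary.All.Properties using () renaming (++⁺ to All-++)
open import Data.List.Relation.Unary.Any using (here; there)
open import Data.Nat using (ℕ; zero; suc; _+_; _≤_; _<_; _≡ᵇ_; z≤n; s≤s)
open import Data.Nat.Properties using
  (suc-injective; ≤-refl; ≤-reflexive; ≤-trans; ≤-antisym; ≤-pred; <-irrefl; <⇒≤; <⇒≱; <⇒≢; ≮⇒≥;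
   ≰⇒>; <-≤-trans; ≤-<-trans; _≤?_; _<?_; n<1+n; 1+n≰n; m≤m+n; m≤n⇒m≤1+n; m≤n⇒m<n∨m≡n;
   m≤n⇒∃[o]m+o≡n; +-comm; +-suc; +-identityʳ; +-mono-≤; +-mono-<)
  renaming (_≟_ to _≟ℕ_)
open import Data.Product using (Σ; Σ-syntax; _×_; _,_; proj₁; proj₂)
open import Data.Product.Function.NonDependent.Propositional using (_×-⇔_; _×-↔_)
open import Data.Sum using (_⊎_; inj₁; inj₂)
open import Data.Sum.Function.Propositional using (_⊎-⇔_; _⊎-↔_)
open import Data.Unit using (⊤; tt)
open import Data.Vec as Vec using (Vec; []; _∷_; lookup; tabulate; replicate)
open import Data.Vec.Properties as Vec using
  (lookup∘tabulate; tabulate∘lookup; tabulate-cong; lookup-replicate)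
open import Function using (_∘_; id; const; _↔_; Inverse; mk↔ₛ′; _⇔_; mk⇔; Equivalence)
open import Function.Properties.Inverse using (↔-sym; ↔-trans; Inverse⇒Injection)
open import Relation.Binary.Construct.Closure.ReflexiveTransitive using (Star; ε; _◅_; _◅◅_)
open import Relation.Binary.Definitions using (DecidableEquality)
open import Relation.Binary.PropositionalEquality using
  (_≡_; _≢_; refl; sym; trans; cong; cong₂; subst; subst₂; _≗_; module ≡-Reasoning)
open import Relation.Nullary using (¬_; Dec; yes; no; does; ¬?; contradiction)
open import Relation.Nullary.Decidable using (_×-dec_; _⊎-dec_; map′; decidable-stable; via-injection)
import Function.Properties.Equivalence as ⇔

open Equivalence using (to; from)

-- Finite types

-- The obstacle is history. The hybrid ∃f keeps the past of the trace, to which its body may return,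
-- while the one of CTL* starts afresh at the current state, so a translation by subformulas has
-- nowhere to put that past. An automaton state is a finite summary of it, and relative to a fixed
-- state the rest of a branch is a question about the future alone. Counter-freeness keeps these
-- questions within LTL; it is carried through every construction as an explicit bound N such that
-- the action x of each word satisfies x^N = x^(N+1). The guard F⁻ x excludes marks beyond the
-- current position: with them a branch would depend on a distance that no finite summary of the
-- prefix contains. The formula is chosen before the structure. Alphabets and automata are therefore
-- independent of it, and only the map from states to letters inspects it. That map has to be
-- computed, which is where finiteness of the structure is used.

Finite : Set → Set
Finite S = Σ[ n ∈ ℕ ] S ↔ Fin n

module Enum {S : Set} (fin : Finite S) where
  size : ℕ
  size = proj₁ fin

  enc : S → Fin size
  enc = Inverse.to (proj₂ fin)

  dec : Fin size → S
  dec = Inverse.from (proj₂ fin)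

  enc-dec : ∀ i → enc (dec i) ≡ i
  enc-dec i = Inverse.inverseˡ (proj₂ fin) refl

  dec-enc : ∀ s → dec (enc s) ≡ s
  dec-enc s = Inverse.inverseʳ (proj₂ fin) refl

  decEq : DecidableEquality S
  decEq = via-injection (Inverse⇒Injection (proj₂ fin)) _≟_

  elements : List S
  elements = map dec (allFin size)

  ∈-elements : ∀ s → s ∈ elements
  ∈-elements s = subst (_∈ elements) (dec-enc s) (∈-map⁺ dec (∈-allFin (enc s)))

finFin : ∀ {n} → Finite (Fin n)
finFin {n} = n , mk↔ₛ′ id id (λ _ → refl) (λ _ → refl)

fin× : ∀ {S T} → Finite S → Finite T → Finite (S × T)
fin× (_ , f) (_ , g) = _ , ↔-trans (f ×-↔ g) (↔-sym *↔×)

finVec : ∀ {S} → Finite S → ∀ n → Finite (Vec S n)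
finVec f zero = 1 , mk↔ₛ′ (λ _ → zero) (λ _ → []) (λ { zero → refl }) (λ { [] → refl })
finVec f (suc n) = _ , ↔-trans cons (proj₂ (fin× f (finVec f n)))
  where
  cons = mk↔ₛ′ (λ xs → Vec.head xs , Vec.tail xs) (λ (x , xs) → x ∷ xs) (λ _ → refl) (λ { (_ ∷ _) → refl })

fin⊎ : ∀ {S T} → Finite S → Finite T → Finite (S ⊎ T)
fin⊎ (_ , f) (_ , g) = _ , ↔-trans (f ⊎-↔ g) (↔-sym +↔⊎)

-- Iteration and runs of automata

private variable
  A B S T : Set

iter : (S → S) → ℕ → S → S
iter f zero    x = x
iter f (suc n) x = iter f n (f x)

iter-sim : (h : S → T) {f : S → S} {g : T → T} → (∀ x → h (f x) ≡ g (h x)) →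
           ∀ n x → h (iter f n x) ≡ iter g n (h x)
iter-sim h sim zero    x = refl
iter-sim h {f} {g} sim (suc n) x = trans (iter-sim h sim n (f x)) (cong (iter g n) (sim x))

-- Counter-freeness of a single transformation: its powers become constant from the exponent `N` on,
-- so it permutes no set of points nontrivially.
Stable : (S → S) → ℕ → Set
Stable f N = ∀ x → iter f N x ≡ iter f (suc N) x

-- Only the image under `h` stabilises, so `h` may be a projection of a product automaton.
stable-image : {f : S → S} {g : T → T} (h : S → T) → (∀ x → h (f x) ≡ g (h x)) →
               ∀ N → Stable g N → ∀ x → h (iter f N x) ≡ h (iter f (suc N) x)
stable-image {f = f} h sim N st x = begin
  h (iter f N x)       ≡⟨ iter-sim h sim N x ⟩
  iter _ N (h x)       ≡⟨ st (h x) ⟩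
  iter _ (suc N) (h x) ≡⟨ iter-sim h sim (suc N) x ⟨
  h (iter f (suc N) x) ∎
  where open ≡-Reasoning

stable-sim : {f : S → S} {g : T → T} (h : S → T) → (∀ {x y} → h x ≡ h y → x ≡ y) →
             (∀ x → h (f x) ≡ g (h x)) → ∀ N → Stable g N → Stable f N
stable-sim h inj sim N st x = inj (stable-image h sim N st x)

stable-+ : ∀ (f : S → S) N d → Stable f N → Stable f (d + N)
stable-+ f N zero    st = st
stable-+ f N (suc d) st x = stable-+ f N d st (f x)

stable-≥ : ∀ (f : S → S) {N M} → N ≤ M → Stable f N → Stable f M
stable-≥ f {N} le st with m≤n⇒∃[o]m+o≡n le
... | d , refl = subst (Stable f) (+-comm d N) (stable-+ f N d st)

run : (A → S → S) → List A → S → S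
run δ []      q = q
run δ (a ∷ w) q = run δ w (δ a q)

run-++ : (δ : A → S → S) → ∀ u v q → run δ (u ++ v) q ≡ run δ v (run δ u q)
run-++ δ []      v q = refl
run-++ δ (a ∷ u) v q = run-++ δ u v (δ a q)

run-sim : {δ : A → S → S} {δ′ : A → T → T} (h : S → T) →
          (∀ a x → h (δ a x) ≡ δ′ a (h x)) → ∀ w x → h (run δ w x) ≡ run δ′ w (h x)
run-sim h sim []      x = refl
run-sim {δ = δ} {δ′} h sim (a ∷ w) x =
  trans (run-sim h sim w (δ a x)) (cong (run δ′ w) (sim a x))

run-map : ∀ (δ : A → S → S) (f : B → A) w q → run (δ ∘ f) w q ≡ run δ (map f w) q
run-map δ f []      q = refl
run-map δ f (b ∷ w) q = run-map δ f w (δ (f b) q)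

-- Future LTL on possibly empty words

data LTL (A : Set) : Set where
  top    : LTL A
  letter : A → LTL A
  neg    : LTL A → LTL A
  _and_  : LTL A → LTL A → LTL A
  next   : LTL A → LTL A
  _until_ : LTL A → LTL A → LTL A

module Semantics {A : Set} (_≟ᴬ_ : DecidableEquality A) where
  sat : LTL A → List A → Bool
  sat top         w       = true
  sat (letter a)  []      = false
  sat (letter a)  (b ∷ w) = does (b ≟ᴬ a)
  sat (neg φ)     w       = not (sat φ w)
  sat (φ and ψ)   w       = sat φ w ∧ sat ψ w
  sat (next φ)    []      = false
  sat (next φ)    (b ∷ w) = sat φ w
  -- The end of the word counts as a position: an until may be fulfilled on the empty suffix.
  sat (φ until ψ) []      = sat ψ []
  sat (φ until ψ) (b ∷ w) = sat ψ (b ∷ w) ∨ (sat φ (b ∷ w) ∧ sat (φ until ψ) w)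

  _or_ : LTL A → LTL A → LTL A
  φ or ψ = neg (neg φ and neg ψ)

  sat-or : ∀ φ ψ w → sat (φ or ψ) w ≡ sat φ w ∨ sat ψ w
  sat-or φ ψ w with sat φ w | sat ψ w
  ... | true  | _     = refl
  ... | false | true  = refl
  ... | false | false = refl

  module Definability (G : A → Set) where
    Def : (List A → Bool) → Set
    Def P = Σ[ φ ∈ LTL A ] (∀ w → All G w → sat φ w ≡ P w)

    def-cong : ∀ {P P′} → (∀ w → All G w → P w ≡ P′ w) → Def P → Def P′
    def-cong eq (φ , ok) = φ , λ w gw → trans (ok w gw) (eq w gw)

    def-neg : ∀ {P} → Def P → Def (not ∘ P)
    def-neg (φ , ok) = neg φ , λ w gw → cong not (ok w gw)

    def-and : ∀ {P Q} → Def P → Def Q → Def (λ w → P w ∧ Q w)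
    def-and (φ , ok) (ψ , ok′) = (φ and ψ) , λ w gw → cong₂ _∧_ (ok w gw) (ok′ w gw)

    def-or : ∀ {P Q} → Def P → Def Q → Def (λ w → P w ∨ Q w)
    def-or (φ , ok) (ψ , ok′) =
      (φ or ψ) , λ w gw → trans (sat-or φ ψ w) (cong₂ _∨_ (ok w gw) (ok′ w gw))

    def-const : ∀ b → Def (λ _ → b)
    def-const true  = top , λ _ _ → refl
    def-const false = neg top , λ _ _ → refl

    def-if : ∀ {C P Q} → Def C → Def P → Def Q → Def (λ w → if C w then P w else Q w)
    def-if {C} {P} {Q} c p q =
      def-cong (λ w _ → eq (C w)) (def-or (def-and c p) (def-and (def-neg c) q))
      where
      eq : ∀ b {x y} → (b ∧ x) ∨ (not b ∧ y) ≡ (if b then x else y)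
      eq true  {x} = ∨-identityʳ x
      eq false     = refl

    -- A finite disjunction over the values of `f`. This is how the intermediate states of a run are
    -- guessed.
    def-case : ∀ {n} (f : List A → Fin n) {P : Fin n → List A → Bool} →
               (∀ t → Def (λ w → does (f w ≟ t))) → (∀ t → Def (P t)) →
               Def (λ w → P (f w) w)
    def-case {n} f {P} df dP =
      def-cong (λ w _ → eq n (f w) {λ t → P t w}) (go n df dP)
      where
      anyB : ∀ m → (Fin m → Bool) → Bool
      anyB zero    g = false
      anyB (suc m) g = g zero ∨ anyB m (g ∘ suc)

      go : ∀ m {Q P : Fin m → List A → Bool} → (∀ t → Def (Q t)) → (∀ t → Def (P t)) →
           Def (λ w → anyB m (λ t → Q t w ∧ P t w))
      go zero    _  _  = def-const false
      go (suc m) dQ dP = def-or (def-and (dQ zero) (dP zero)) (go m (dQ ∘ suc) (dP ∘ suc))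

      none : ∀ m → anyB m (λ _ → false) ≡ false
      none zero    = refl
      none (suc m) = none m

      eq : ∀ m (s : Fin m) {g : Fin m → Bool} → anyB m (λ t → does (s ≟ t) ∧ g t) ≡ g s
      eq (suc m) zero    {g} = trans (cong (g zero ∨_) (none m)) (∨-identityʳ (g zero))
      eq (suc m) (suc s) {g} = eq m s {g ∘ suc}

    -- The letters of the block automaton are vectors with one target state for each starting state;
    -- testing for such a letter is a conjunction of tests on runs.
    def-tabulate : ∀ n {m} (f : Fin n → List A → Fin m) →
                   (∀ q t → Def (λ w → does (f q w ≟ t))) →
                   ∀ α → Def (λ w → does (Vec.≡-dec _≟_ (tabulate (λ q → f q w)) α))
    def-tabulate zero    f df []      = def-const true
    def-tabulate (suc n) f df (t ∷ α) =
      def-and (df zero t) (def-tabulate n (f ∘ suc) (df ∘ suc) α)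

-- Factorisation of words at the occurrences of a letter c

module Factor {A : Set} (_≟ᴬ_ : DecidableEquality A) (G : A → Set) (c : A) where
  open Semantics _≟ᴬ_
  open Definability G

  hasC : List A → Bool
  hasC []      = false
  hasC (b ∷ w) = does (b ≟ᴬ c) ∨ hasC w

  pre rest lastBlock : List A → List A

  pre []      = []
  pre (b ∷ w) = if does (b ≟ᴬ c) then [] else b ∷ pre w

  rest []      = []
  rest (b ∷ w) = if does (b ≟ᴬ c) then w else rest w

  lastBlock []      = []
  lastBlock (b ∷ w) = if hasC (b ∷ w) then lastBlock w else b ∷ w

  All-pre : ∀ {w} → All G w → All G (pre w)
  All-pre [] = []
  All-pre {b ∷ w} (g ∷ gw) with b ≟ᴬ c
  ... | yes _ = []
  ... | no  _ = g ∷ All-pre gw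

  All-rest : ∀ {w} → All G w → All G (rest w)
  All-rest [] = []
  All-rest {b ∷ w} (g ∷ gw) with b ≟ᴬ c
  ... | yes _ = gw
  ... | no  _ = All-rest gw

  -- An occurrence of `c` has to behave like the end of the word: no letter and no `next` holds
  -- there, and an `until` may be fulfilled there but cannot pass it.
  relativise : LTL A → LTL A
  relativise top         = top
  relativise (letter a)  = letter a and neg (letter c)
  relativise (neg φ)     = neg (relativise φ)
  relativise (φ and ψ)   = relativise φ and relativise ψ
  relativise (next φ)    = neg (letter c) and next (relativise φ)
  relativise (φ until ψ) = (neg (letter c) and relativise φ) until relativise ψ

  sat-relativise : ∀ φ w → sat (relativise φ) w ≡ sat φ (pre w)
  sat-relativise top w = refl
  sat-relativise (letter a) [] = refl
  sat-relativise (letter a) (b ∷ w) with b ≟ᴬ c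
  ... | yes _ = ∧-zeroʳ _
  ... | no  _ = ∧-identityʳ _
  sat-relativise (neg φ) w = cong not (sat-relativise φ w)
  sat-relativise (φ and ψ) w = cong₂ _∧_ (sat-relativise φ w) (sat-relativise ψ w)
  sat-relativise (next φ) [] = refl
  sat-relativise (next φ) (b ∷ w) with b ≟ᴬ c
  ... | yes _ = refl
  ... | no  _ = sat-relativise φ w
  sat-relativise (φ until ψ) [] = sat-relativise ψ []
  sat-relativise (φ until ψ) (b ∷ w) = trans
    (cong₂ _∨_ (sat-relativise ψ (b ∷ w))
      (cong₂ (λ x y → (not (does (b ≟ᴬ c)) ∧ x) ∧ y)
        (sat-relativise φ (b ∷ w)) (sat-relativise (φ until ψ) w)))
    unfold
    where
    unfold : sat ψ (pre (b ∷ w)) ∨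
             ((not (does (b ≟ᴬ c)) ∧ sat φ (pre (b ∷ w))) ∧ sat (φ until ψ) (pre w))
             ≡ sat (φ until ψ) (pre (b ∷ w))
    unfold with b ≟ᴬ c
    ... | yes _ = ∨-identityʳ _
    ... | no  _ = refl

  def-pre : ∀ {P} → Def P → Def (P ∘ pre)
  def-pre (φ , ok) = relativise φ , λ w gw → trans (sat-relativise φ w) (ok (pre w) (All-pre gw))

  afterC : LTL A → LTL A
  afterC φ = neg (letter c) until (letter c and next φ)

  sat-afterC : ∀ φ w → sat (afterC φ) w ≡ hasC w ∧ sat φ (rest w)
  sat-afterC φ [] = refl
  sat-afterC φ (b ∷ w) with b ≟ᴬ c
  ... | yes _ = ∨-identityʳ _
  ... | no  _ = sat-afterC φ w

  def-afterC : ∀ {P} → Def P → Def (λ w → hasC w ∧ P (rest w))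
  def-afterC (φ , ok) =
    afterC φ , λ w gw → trans (sat-afterC φ w) (cong (hasC w ∧_) (ok (rest w) (All-rest gw)))

  def-hasC : Def hasC
  def-hasC = def-cong (λ w _ → ∧-identityʳ (hasC w)) (def-afterC (def-const true))

  -- The last block is the first suffix without `c`, which an until can wait for; there is one,
  -- since the empty suffix counts.
  def-lastBlock : ∀ {P} → Def P → Def (P ∘ lastBlock)
  def-lastBlock {P} (φ , ok) = (proj₁ def-hasC until ψ) , go
    where
    ψ : LTL A
    ψ = neg (proj₁ def-hasC) and φ
    go : ∀ w → All G w → sat (proj₁ def-hasC until ψ) w ≡ P (lastBlock w)
    go [] gw = ok [] gw
    go (b ∷ w) gbw@(g ∷ gw) rewrite proj₂ def-hasC (b ∷ w) gbw | ok (b ∷ w) gbw | go w gw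
      with hasC (b ∷ w)
    ... | true  = refl
    ... | false = ∨-identityʳ _

-- Counter-free automata

-- The restriction to words over G is needed for the automata on blocks below, whose
-- alphabet contains functions that are not realised by any word.
Aperiodic : (A → Set) → (A → S → S) → ℕ → Set
Aperiodic G δ N = ∀ u → All G u → Stable (run δ u) N

module Mute {A : Set} (_≟ᴬ_ : DecidableEquality A) (G : A → Set) {n : ℕ}
            (δ : A → Fin n → Fin n) (c : A) where
  open Factor _≟ᴬ_ G c

  -- Letting `c` act as the identity removes it from the letters on which the induction runs, and
  -- changes nothing on words without `c`.
  mute : A → Fin n → Fin n
  mute b q = if does (b ≟ᴬ c) then q else δ b q

  drop-c : List A → List A
  drop-c []      = []
  drop-c (b ∷ w) = if does (b ≟ᴬ c) then drop-c w else b ∷ drop-c w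

  All-drop-c : ∀ {w} → All G w → All G (drop-c w)
  All-drop-c [] = []
  All-drop-c {b ∷ w} (g ∷ gw) with b ≟ᴬ c
  ... | yes _ = All-drop-c gw
  ... | no  _ = g ∷ All-drop-c gw

  run-mute : ∀ w q → run mute w q ≡ run δ (drop-c w) q
  run-mute [] q = refl
  run-mute (b ∷ w) q with b ≟ᴬ c
  ... | yes _ = run-mute w q
  ... | no  _ = run-mute w (δ b q)

  run-mute-pre : ∀ w q → run mute (pre w) q ≡ run δ (pre w) q
  run-mute-pre [] q = refl
  run-mute-pre (b ∷ w) q with b ≟ᴬ c in eq
  ... | yes _ = refl
  ... | no  _ rewrite eq = run-mute-pre w (δ b q)

  run-mute-noC : ∀ w q → hasC w ≡ false → run mute w q ≡ run δ w q
  run-mute-noC [] q _ = refl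
  run-mute-noC (b ∷ w) q eq with b ≟ᴬ c
  ... | no _ = run-mute-noC w (δ b q) eq

  mute-outside : ∀ {bs} → (∀ b → b ∉ c ∷ bs → ∀ q → δ b q ≡ q) →
                 ∀ b → b ∉ bs → ∀ q → mute b q ≡ q
  mute-outside triv b b∉ q with b ≟ᴬ c
  ... | yes _ = refl
  ... | no b≢ = triv b (λ { (here b≡) → b≢ b≡ ; (there b∈) → b∉ b∈ }) q

  -- A muted run on `u` is an ordinary run on `u` with every `c` deleted.
  aperiodic-mute : ∀ N → Aperiodic G δ N → Aperiodic G mute N
  aperiodic-mute N ap u gu = stable-sim id id (run-mute u) N (ap (drop-c u) (All-drop-c gu))

-- If c misses the state p, then after each c the automaton is in one of the
-- remaining m states, and the blocks between two occurrences of c are the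
-- letters of an automaton on these m states.
module Blocks {A : Set} (_≟ᴬ_ : DecidableEquality A) (G : A → Set) {m : ℕ}
              (δ : A → Fin (suc m) → Fin (suc m)) (c : A)
              (p : Fin (suc m)) (miss : ∀ q → δ c q ≢ p) where
  open Factor _≟ᴬ_ G c
  open Semantics _≟ᴬ_
  open Definability G
  open Mute _≟ᴬ_ G δ c

  Q : Set
  Q = Fin (suc m)

  Block : Set
  Block = Vec Q (suc m)

  _≟ᴮ_ : DecidableEquality Block
  _≟ᴮ_ = Vec.≡-dec _≟_

  toQ : Fin m → Q
  toQ = punchIn p

  afterc : Q → Fin m
  afterc q = punchOut {i = p} {j = δ c q} (miss q ∘ sym)

  toQ-afterc : ∀ q → toQ (afterc q) ≡ δ c q
  toQ-afterc q = punchIn-punchOut (miss q ∘ sym)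

  -- A letter is the transition function of a block, and reading it includes the `c` that closes the
  -- block; so the result avoids `p`.
  δᴮ : Block → Fin m → Fin m
  δᴮ α s = afterc (lookup α (toQ s))

  -- `f` accumulates the transition function of the block being read. The block after the last `c`
  -- is never closed and hence not emitted.
  blocks : (Q → Q) → List A → List Block
  blocks f []      = []
  blocks f (b ∷ w) = if does (b ≟ᴬ c) then tabulate f ∷ blocks id w else blocks (δ b ∘ f) w

  run-split : ∀ w q → run δ w q ≡
    (if hasC w then run δ (rest w) (δ c (run δ (pre w) q)) else run δ (pre w) q)
  run-split [] q = refl
  run-split (b ∷ w) q with b ≟ᴬ c
  ... | yes refl = refl
  ... | no  _    = run-split w (δ b q)

  blocks-split : ∀ f w → blocks f w ≡
    (if hasC w then tabulate (λ q → run δ (pre w) (f q)) ∷ blocks id (rest w) else [])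
  blocks-split f [] = refl
  blocks-split f (b ∷ w) with b ≟ᴬ c
  ... | yes _ = refl
  ... | no  _ = blocks-split (δ b ∘ f) w

  blocks-noC : ∀ {f} w → hasC w ≡ false → blocks f w ≡ []
  blocks-noC {f} w eq = trans (blocks-split f w)
    (cong (if_then tabulate (λ q → run δ (pre w) (f q)) ∷ blocks id (rest w) else []) eq)

  run-blocks : ∀ f w s → run δ w (f (toQ s)) ≡ run δ (lastBlock w)
    (if hasC w then toQ (run δᴮ (blocks f w) s) else f (toQ s))
  run-blocks f [] s = refl
  run-blocks f (b ∷ w) s with b ≟ᴬ c
  ... | no  _ with hasC w in eq
  ...   | true = trans (run-blocks (δ b ∘ f) w s)
                   (cong (λ z → run δ (lastBlock w)
                     (if z then toQ (run δᴮ (blocks (δ b ∘ f) w) s) else δ b (f (toQ s)))) eq)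
  ...   | false = refl
  run-blocks f (b ∷ w) s | yes refl
    rewrite sym (toQ-afterc (f (toQ s))) | lookup∘tabulate f (toQ s)
    with hasC w in eq | run-blocks id w (afterc (f (toQ s)))
  ... | true  | ih = ih
  ... | false | ih rewrite blocks-noC {id} w eq = ih

  -- `δᴮ` uses a block only together with its closing `c`, so only this composite has to come from a
  -- word.
  Realised : Block → Set
  Realised α = Σ[ u ∈ List A ] All G u × (∀ q → δ c (lookup α q) ≡ run δ u q)

  All-blocks : ∀ f v → All G v → (∀ q → f q ≡ run δ v q) → ∀ w → All G w →
               All Realised (blocks f w)
  All-blocks f v gv eq [] [] = []
  All-blocks f v gv eq (b ∷ w) (g ∷ gw) with b ≟ᴬ c
  ... | yes refl = (v ++ c ∷ [] , All-++ gv (g ∷ []) , λ q → begin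
      δ c (lookup (tabulate f) q) ≡⟨ cong (δ c) (trans (lookup∘tabulate f q) (eq q)) ⟩
      δ c (run δ v q)             ≡⟨ run-++ δ v (c ∷ []) q ⟨
      run δ (v ++ c ∷ []) q       ∎) ∷ All-blocks id [] [] (λ _ → refl) w gw
    where open ≡-Reasoning
  ... | no _ = All-blocks (δ b ∘ f) (v ++ b ∷ []) (All-++ gv (g ∷ []))
                 (λ q → trans (cong (δ b) (eq q)) (sym (run-++ δ v (b ∷ []) q))) w gw

  flatten : ∀ {U} → All Realised U →
            Σ[ u ∈ List A ] All G u × (∀ s → toQ (run δᴮ U s) ≡ run δ u (toQ s))
  flatten [] = [] , [] , λ _ → refl
  flatten {α ∷ U} ((u , gu , eq) ∷ r) with flatten r
  ... | v , gv , eq′ = u ++ v , All-++ gu gv , λ s → begin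
      toQ (run δᴮ U (afterc (lookup α (toQ s))))  ≡⟨ eq′ _ ⟩
      run δ v (toQ (afterc (lookup α (toQ s))))   ≡⟨ cong (run δ v) (trans (toQ-afterc _) (eq (toQ s))) ⟩
      run δ v (run δ u (toQ s))                   ≡⟨ run-++ δ u v (toQ s) ⟨
      run δ (u ++ v) (toQ s)                      ∎
    where open ≡-Reasoning

  -- Seen through the injection `toQ`, a word of realised blocks acts like a word over `A`, so the
  -- bound `N` carries over unchanged.
  aperiodic-blocks : ∀ N → Aperiodic G δ N → Aperiodic Realised δᴮ N
  aperiodic-blocks N ap U r with flatten r
  ... | u , gu , eq = stable-sim toQ (punchIn-injective p _ _) eq N (ap u gu)

  module B = Semantics _≟ᴮ_

  -- Modalities on the block word are simulated at the positions following c.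
  module Translate (pre-def : ∀ q t → Def (λ w → does (run δ (pre w) q ≟ t))) where
    block : Block → LTL A
    block α = proj₁ (def-tabulate (suc m) (λ q w → run δ (pre w) q) pre-def α)

    translate : LTL Block → LTL A
    jump : LTL Block → LTL Block → LTL A

    translate top         = top
    translate (letter α)  = proj₁ def-hasC and block α
    translate (neg φ)     = neg (translate φ)
    translate (φ and ψ)   = translate φ and translate ψ
    translate (next φ)    = afterC (translate φ)
    -- The current position begins the first block without needing a `c` in front of it, so one step
    -- of the until is unrolled; `jump` handles the later positions, which all follow a `c`.
    translate (φ until ψ) = translate ψ or (translate φ and jump φ ψ)

    jump φ ψ = neg (letter c and neg (next (translate φ))) until (letter c and next (translate ψ))

    mutual
      sat-translate : ∀ φ w → All G w → sat (translate φ) w ≡ B.sat φ (blocks id w)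
      sat-translate top w gw = refl
      sat-translate (letter α) w gw
        rewrite proj₂ def-hasC w gw | blocks-split id w
              | proj₂ (def-tabulate (suc m) (λ q w → run δ (pre w) q) pre-def α) w gw
        with hasC w
      ... | true  = refl
      ... | false = refl
      sat-translate (neg φ) w gw = cong not (sat-translate φ w gw)
      sat-translate (φ and ψ) w gw = cong₂ _∧_ (sat-translate φ w gw) (sat-translate ψ w gw)
      sat-translate (next φ) w gw
        rewrite sat-afterC (translate φ) w | sat-translate φ (rest w) (All-rest gw) | blocks-split id w
        with hasC w
      ... | true  = refl
      ... | false = refl
      sat-translate (φ until ψ) w gw = begin
        sat (translate ψ or (translate φ and jump φ ψ)) w
          ≡⟨ sat-or (translate ψ) (translate φ and jump φ ψ) w ⟩
        sat (translate ψ) w ∨ (sat (translate φ) w ∧ sat (jump φ ψ) w)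
          ≡⟨ cong (λ z → sat (translate ψ) w ∨ (sat (translate φ) w ∧ z)) (sat-jump φ ψ w gw) ⟩
        sat (translate ψ) w ∨ (sat (translate φ) w ∧ (hasC w ∧ B.sat (φ until ψ) (blocks id (rest w))))
          ≡⟨ unfold-until φ ψ w gw ⟩
        B.sat (φ until ψ) (blocks id w) ∎
        where open ≡-Reasoning

      unfold-until : ∀ φ ψ w → All G w →
        sat (translate ψ) w ∨ (sat (translate φ) w ∧ (hasC w ∧ B.sat (φ until ψ) (blocks id (rest w))))
        ≡ B.sat (φ until ψ) (blocks id w)
      unfold-until φ ψ w gw
        rewrite sat-translate ψ w gw | sat-translate φ w gw | blocks-split id w
        with hasC w
      ... | true  = refl
      ... | false = trans (cong (B.sat ψ [] ∨_) (∧-zeroʳ _)) (∨-identityʳ _)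

      sat-jump : ∀ φ ψ w → All G w →
                 sat (jump φ ψ) w ≡ hasC w ∧ B.sat (φ until ψ) (blocks id (rest w))
      sat-jump φ ψ [] [] = refl
      sat-jump φ ψ (b ∷ w) (g ∷ gw) with b ≟ᴬ c
      ... | no  _ = sat-jump φ ψ w gw
      ... | yes _ = trans (cong (sat (translate ψ) w ∨_)
                            (cong₂ _∧_ (not-involutive (sat (translate φ) w)) (sat-jump φ ψ w gw)))
                          (unfold-until φ ψ w gw)

    def-blocks : ∀ {P} → B.Definability.Def Realised P → Def (P ∘ blocks id)
    def-blocks (φ , ok) = translate φ , λ w gw →
      trans (sat-translate φ w gw) (ok (blocks id w) (All-blocks id [] [] (λ _ → refl) w gw))

  -- run δ w q is determined by the first block, the block word between the
  -- first and the last c, and the last block.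
  def-run : (∀ q t → Def (λ w → does (run mute w q ≟ t))) →
            (∀ s t → B.Definability.Def Realised (λ w → does (run δᴮ w s ≟ t))) →
            ∀ q t → Def (λ w → does (run δ w q ≟ t))
  def-run dmute dᴮ q t =
    def-cong (λ w _ → sym (eq w))
      (def-if def-hasC
        (def-case (λ w → run δ (pre w) q) (pre-def q) (λ q′ → def-afterC
          (def-case (λ v → run δᴮ (blocks id v) (afterc q′)) (λ s → def-blocks (dᴮ (afterc q′) s))
            (λ s → def-lastBlock (dmute (toQ s) t)))))
        (pre-def q t))
    where
    pre-def : ∀ q t → Def (λ w → does (run δ (pre w) q ≟ t))
    pre-def q t = def-cong (λ w _ → cong (λ z → does (z ≟ t)) (run-mute-pre w q)) (def-pre (dmute q t))

    open Translate pre-def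

    hasC-lastBlock : ∀ v → hasC (lastBlock v) ≡ false
    hasC-lastBlock [] = refl
    hasC-lastBlock (b ∷ v) with hasC (b ∷ v) in eq
    ... | true  = hasC-lastBlock v
    ... | false = eq

    run-rest : ∀ v q′ → run δ v (δ c q′) ≡
               run mute (lastBlock v) (toQ (run δᴮ (blocks id v) (afterc q′)))
    run-rest v q′ = begin
      run δ v (δ c q′)           ≡⟨ cong (run δ v) (toQ-afterc q′) ⟨
      run δ v (toQ (afterc q′))  ≡⟨ run-blocks id v (afterc q′) ⟩
      run δ (lastBlock v) (if hasC v then toQ (run δᴮ (blocks id v) (afterc q′)) else toQ (afterc q′))
                                 ≡⟨ cong (run δ (lastBlock v)) absorb ⟩
      run δ (lastBlock v) (toQ (run δᴮ (blocks id v) (afterc q′)))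
                                 ≡⟨ run-mute-noC (lastBlock v) _ (hasC-lastBlock v) ⟨
      run mute (lastBlock v) (toQ (run δᴮ (blocks id v) (afterc q′))) ∎
      where
      open ≡-Reasoning
      absorb : (if hasC v then toQ (run δᴮ (blocks id v) (afterc q′)) else toQ (afterc q′))
               ≡ toQ (run δᴮ (blocks id v) (afterc q′))
      absorb rewrite blocks-split id v with hasC v
      ... | true  = refl
      ... | false = refl

    eq : ∀ w → does (run δ w q ≟ t) ≡
         (if hasC w then hasC w ∧ does (run mute (lastBlock (rest w))
              (toQ (run δᴮ (blocks id (rest w)) (afterc (run δ (pre w) q)))) ≟ t)
          else does (run δ (pre w) q ≟ t))
    eq w rewrite run-split w q with hasC w
    ... | true  = cong (λ z → does (z ≟ t)) (run-rest (rest w) (run δ (pre w) q))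
    ... | false = refl

module LetterStep {A : Set} (_≟ᴬ_ : DecidableEquality A) (G : A → Set) {m : ℕ}
                  (δ : A → Fin (suc m) → Fin (suc m)) (c : A) {N : ℕ}
                  (ap : Aperiodic G δ N) where
  open Semantics _≟ᴬ_
  open Definability G
  open Mute _≟ᴬ_ G δ c

  module _ (onto : ∀ p → Σ[ q ∈ Fin (suc m) ] δ c q ≡ p) where
    onto-iter : ∀ k p → Σ[ q ∈ Fin (suc m) ] iter (δ c) k q ≡ p
    onto-iter zero    p = p , refl
    onto-iter (suc k) p with onto-iter k p
    ... | q , eq with onto q
    ...   | q′ , eq′ = q′ , trans (cong (iter (δ c) k) eq′) eq

    -- p = cᴺ q for some q, and cᴺ⁺¹ q = cᴺ q.
    onto⇒id : G c → ∀ p → δ c p ≡ p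
    onto⇒id gc p with onto-iter N p
    ... | q , refl = trans (iter-sim (δ c) (λ _ → refl) N q) (sym (ap (c ∷ []) (gc ∷ []) q))

    onto⇒run-mute : ∀ w → All G w → ∀ q → run mute w q ≡ run δ w q
    onto⇒run-mute [] [] q = refl
    onto⇒run-mute (b ∷ w) (g ∷ gw) q with b ≟ᴬ c
    ... | yes refl = trans (onto⇒run-mute w gw q) (cong (run δ w) (sym (onto⇒id g q)))
    ... | no  _    = onto⇒run-mute w gw (δ b q)

  module _ (p : Fin (suc m)) (miss : ∀ q → δ c q ≢ p) where
    open Blocks _≟ᴬ_ G δ c p miss using (module B; Realised; δᴮ)

    BlockDef : Set
    BlockDef = ∀ s t → B.Definability.Def Realised (λ w → does (run δᴮ w s ≟ t))

  -- Either `c` misses a state, and the blocks get by with one state less; or `c` is onto, hence the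
  -- identity by counter-freeness, and muting it does not change any run over `G`.
  def-step : (∀ q t → Def (λ w → does (run mute w q ≟ t))) → (∀ p miss → BlockDef p miss) →
             ∀ q t → Def (λ w → does (run δ w q ≟ t))
  def-step dmute dᴮ with any? (λ p → all? (λ q → ¬? (δ c q ≟ p)))
  ... | yes (p , miss) = Blocks.def-run _≟ᴬ_ G δ c p miss dmute (dᴮ p miss)
  ... | no ¬miss = λ q t →
    def-cong (λ w gw → cong (λ z → does (z ≟ t)) (onto⇒run-mute onto w gw q)) (dmute q t)
    where
    onto : ∀ p → Σ[ q ∈ Fin (suc m) ] δ c q ≡ p
    onto p with any? (λ q → δ c q ≟ p)
    ... | yes r = r
    ... | no ¬r = ⊥-elim (¬miss (p , λ q eq → ¬r (q , eq)))

-- Lexicographic induction on the number of states and the list `bs` of letters that may act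
-- nontrivially. Muting keeps the states and shortens `bs`; passing to blocks enlarges the alphabet
-- to all state vectors but loses a state.
counterFree⇒LTL : ∀ n {A : Set} (_≟ᴬ_ : DecidableEquality A) (G : A → Set) (δ : A → Fin n → Fin n)
  (N : ℕ) → (bs : List A) → (∀ b → b ∉ bs → ∀ q → δ b q ≡ q) → Aperiodic G δ N →
  ∀ q t → Semantics.Definability.Def _≟ᴬ_ G (λ w → does (run δ w q ≟ t))
counterFree⇒LTL (suc m) _≟ᴬ_ G δ N [] triv ap q t =
  def-cong (λ w _ → cong (λ z → does (z ≟ t)) (sym (run-id w q))) (def-const (does (q ≟ t)))
  where
  open Semantics _≟ᴬ_
  open Definability G
  run-id : ∀ w q → run δ w q ≡ q
  run-id []      q = refl
  run-id (b ∷ w) q = trans (run-id w (δ b q)) (triv b (λ ()) q)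
counterFree⇒LTL (suc m) _≟ᴬ_ G δ N (c ∷ bs) triv ap =
  def-step
    (counterFree⇒LTL (suc m) _≟ᴬ_ G mute N bs (mute-outside triv) (aperiodic-mute N ap))
    (λ p miss → let open Blocks _≟ᴬ_ G δ c p miss in
      counterFree⇒LTL m _≟ᴮ_ Realised δᴮ N
        elements (λ b b∉ → ⊥-elim (b∉ (∈-elements b))) (aperiodic-blocks N ap))
  where
  open LetterStep _≟ᴬ_ G δ c {N} ap
  open Mute _≟ᴬ_ G δ c
  open Enum (finVec (finFin {suc m}) (suc m))

-- Deciding reachability in a finite graph by adding the intermediate
-- nodes one at a time.

module Reachability {X : Set} (_≟_ : DecidableEquality X) (E : X → X → Set)
                    (E? : ∀ x y → Dec (E x y)) (nodes : List X) (complete : ∀ x → x ∈ nodes) where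
  Via : List X → X → X → Set
  Via []       x y = x ≡ y ⊎ E x y
  Via (z ∷ zs) x y = Via zs x y ⊎ (Via zs x z × Via zs z y)

  via? : ∀ zs x y → Dec (Via zs x y)
  via? []       x y = (x ≟ y) ⊎-dec E? x y
  via? (z ∷ zs) x y = via? zs x y ⊎-dec (via? zs x z ×-dec via? zs z y)

  via⇒star : ∀ zs {x y} → Via zs x y → Star E x y
  via⇒star []       (inj₁ refl)    = ε
  via⇒star []       (inj₂ e)       = e ◅ ε
  via⇒star (z ∷ zs) (inj₁ p)       = via⇒star zs p
  via⇒star (z ∷ zs) (inj₂ (p , q)) = via⇒star zs p ◅◅ via⇒star zs q

  via-base : ∀ zs {x y} → x ≡ y ⊎ E x y → Via zs x y
  via-base []       e = e
  via-base (z ∷ zs) e = inj₁ (via-base zs e)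

  via-trans : ∀ zs {x z y} → z ∈ zs → Via zs x z → Via zs z y → Via zs x y
  via-trans (_ ∷ zs) (here refl) (inj₁ p)       (inj₁ q)       = inj₂ (p , q)
  via-trans (_ ∷ zs) (here refl) (inj₁ p)       (inj₂ (_ , q)) = inj₂ (p , q)
  via-trans (_ ∷ zs) (here refl) (inj₂ (p , _)) (inj₁ q)       = inj₂ (p , q)
  via-trans (_ ∷ zs) (here refl) (inj₂ (p , _)) (inj₂ (_ , q)) = inj₂ (p , q)
  via-trans (_ ∷ zs) (there z∈)  (inj₁ p)       (inj₁ q)       = inj₁ (via-trans zs z∈ p q)
  via-trans (_ ∷ zs) (there z∈)  (inj₁ p)       (inj₂ (q , r)) = inj₂ (via-trans zs z∈ p q , r)
  via-trans (_ ∷ zs) (there z∈)  (inj₂ (p , q)) (inj₁ r)       = inj₂ (p , via-trans zs z∈ q r)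
  via-trans (_ ∷ zs) (there z∈)  (inj₂ (p , _)) (inj₂ (_ , r)) = inj₂ (p , r)

  star⇒via : ∀ {x y} → Star E x y → Via nodes x y
  star⇒via ε       = via-base nodes (inj₁ refl)
  star⇒via (e ◅ s) = via-trans nodes (complete _) (via-base nodes (inj₂ e)) (star⇒via s)

  reach? : ∀ x y → Dec (Star E x y)
  reach? x y = map′ (via⇒star nodes) star⇒via (via? nodes x y)

-- Positions of a sequence

module _ {X : Set} where
  before after : ∀ {m} (f : Fin (suc m) → X) → Fin (suc m) → List X
  before         f zero    = []
  before {suc m} f (suc i) = f zero ∷ before (f ∘ suc) i

  after         f zero    = List.tabulate (f ∘ suc)
  after {suc m} f (suc i) = after (f ∘ suc) i

  tabulate-split : ∀ {m} (f : Fin (suc m) → X) i → List.tabulate f ≡ before f i ++ f i ∷ after f i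
  tabulate-split         f zero    = refl
  tabulate-split {suc m} f (suc i) = cong (f zero ∷_) (tabulate-split (f ∘ suc) i)

  length-before : ∀ {m} (f : Fin (suc m) → X) i → length (before f i) ≡ toℕ i
  length-before         f zero    = refl
  length-before {suc m} f (suc i) = cong suc (length-before (f ∘ suc) i)

  record SplitAt {m} (f : Fin (suc m) → X) (u : List X) (x : X) (w : List X) : Set where
    constructor splitAt
    field
      pos   : Fin (suc m)
      ≡before : before f pos ≡ u
      ≡here : f pos ≡ x
      ≡after : after f pos ≡ w

  locate : ∀ {m} (f : Fin (suc m) → X) u {x w} → List.tabulate f ≡ u ++ x ∷ w → SplitAt f u x w
  locate         f []      eq = splitAt zero refl (∷-injectiveˡ eq) (∷-injectiveʳ eq)
  locate {zero}  f (y ∷ [])    eq with ∷-injectiveʳ eq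
  ... | ()
  locate {zero}  f (y ∷ _ ∷ _) eq with ∷-injectiveʳ eq
  ... | ()
  locate {suc m} f (y ∷ u) eq with locate (f ∘ suc) u (∷-injectiveʳ eq)
  ... | splitAt i b h a = splitAt (suc i) (cong₂ _∷_ (∷-injectiveˡ eq) b) h a

  Agree : ∀ {m m′} → (Fin (suc m) → X) → (Fin (suc m′) → X) → ℕ → Set
  Agree f g b = ∀ i j → toℕ i ≡ toℕ j → toℕ i ≤ b → f i ≡ g j

  agree⇒before : ∀ {m m′} (f : Fin (suc m) → X) (g : Fin (suc m′) → X) i j → toℕ i ≡ toℕ j →
                 Agree f g (toℕ i) → before f i ≡ before g j
  agree⇒before f g zero zero _ _ = refl
  agree⇒before {suc m} {suc m′} f g (suc i) (suc j) eq ag =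
    cong₂ _∷_ (ag zero zero refl z≤n)
      (agree⇒before (f ∘ suc) (g ∘ suc) i j (suc-injective eq)
        (λ a b e l → ag (suc a) (suc b) (cong suc e) (s≤s l)))

  before⇒agree : ∀ {m m′} (f : Fin (suc m) → X) (g : Fin (suc m′) → X) i j →
                 before f i ≡ before g j → f i ≡ g j → Agree f g (toℕ i)
  before⇒agree f g zero zero _ eq zero zero _ _ = eq
  before⇒agree {m} {suc _} f g zero (suc _) () eq
  before⇒agree {suc _} {m} f g (suc _) zero () eq
  before⇒agree {suc m} {suc m′} f g (suc i) (suc j) eqb eq zero zero _ _ = ∷-injectiveˡ eqb
  before⇒agree {suc m} {suc m′} f g (suc i) (suc j) eqb eq (suc a) (suc b) e (s≤s l) =
    before⇒agree (f ∘ suc) (g ∘ suc) i j (∷-injectiveʳ eqb) eq a b (suc-injective e) l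

  -- A suffix of a trace is kept as its first state and the list of the others, which makes it
  -- non-empty by construction.
  Next : (X → List X → Set) → X → List X → Set
  Next P s []      = ⊥
  Next P s (t ∷ w) = P t w

  Until : (P Q : X → List X → Set) → X → List X → Set
  Until P Q s []      = Q s []
  Until P Q s (t ∷ w) = Q s (t ∷ w) ⊎ (P s (t ∷ w) × Until P Q t w)

  next⇔ : ∀ {m} (f : Fin (suc m) → X) {P : Fin (suc m) → Set} {R : X → List X → Set} →
          (∀ j → P j ⇔ R (f j) (after f j)) →
          ∀ i → (Σ[ j ∈ Fin (suc m) ] (toℕ j ≡ suc (toℕ i)) × P j) ⇔ Next R (f i) (after f i)
  next⇔ {zero} f pr zero = mk⇔ (λ { (zero , () , _) }) (λ ())
  next⇔ {suc m} f pr zero =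
    mk⇔ (λ { (suc zero , _ , p) → to (pr (suc zero)) p ; (suc (suc _) , () , _) })
        (λ r → suc zero , refl , from (pr (suc zero)) r)
  next⇔ {suc m} f pr (suc i) = ⇔.trans
    (mk⇔ (λ { (suc j , eq , p) → j , suc-injective eq , p }) (λ (j , eq , p) → suc j , cong suc eq , p))
    (next⇔ (f ∘ suc) (pr ∘ suc) i)

  UntilAt : ∀ {m} (P Q : Fin (suc m) → Set) → Fin (suc m) → Set
  UntilAt {m} P Q i = Σ[ j ∈ Fin (suc m) ] (toℕ i ≤ toℕ j) × Q j
    × ((l : Fin (suc m)) → toℕ i ≤ toℕ l → toℕ l < toℕ j → P l)

  until⇔ : ∀ {m} (f : Fin (suc m) → X) {P Q : Fin (suc m) → Set} {R S : X → List X → Set} →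
           (∀ j → P j ⇔ R (f j) (after f j)) → (∀ j → Q j ⇔ S (f j) (after f j)) →
           ∀ i → UntilAt P Q i ⇔ Until R S (f i) (after f i)
  until⇔ {zero} f pr qs zero =
    mk⇔ (λ { (zero , _ , q , _) → to (qs zero) q }) (λ s → zero , z≤n , from (qs zero) s , λ _ _ ())
  until⇔ {suc m} f {P} {Q} {R} {S} pr qs zero = mk⇔ fwd bwd
    where
    rec : UntilAt (P ∘ suc) (Q ∘ suc) zero ⇔ Until R S (f (suc zero)) (after f (suc zero))
    rec = until⇔ (f ∘ suc) (pr ∘ suc) (qs ∘ suc) zero
    fwd : UntilAt P Q zero → Until R S (f zero) (after f zero)
    fwd (zero  , _ , q , _) = inj₁ (to (qs zero) q)
    fwd (suc j , _ , q , p) = inj₂ (to (pr zero) (p zero z≤n (s≤s z≤n)) ,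
      to rec (j , z≤n , q , λ l _ l< → p (suc l) z≤n (s≤s l<)))
    bwd : Until R S (f zero) (after f zero) → UntilAt P Q zero
    bwd (inj₁ s) = zero , z≤n , from (qs zero) s , λ _ _ ()
    bwd (inj₂ (r , u)) with from rec u
    ... | j , _ , q , p = suc j , z≤n , q ,
      λ { zero _ _ → from (pr zero) r ; (suc l) _ (s≤s l<) → p l z≤n l< }
  until⇔ {suc m} f {P} {Q} pr qs (suc i) = ⇔.trans
    (mk⇔ (λ { (suc j , s≤s le , q , p) → j , le , q , λ l le l< → p (suc l) (s≤s le) (s≤s l<) })
         (λ (j , le , q , p) → suc j , s≤s le , q ,
           λ { (suc l) (s≤s le) (s≤s l<) → p l le l< }))
    (until⇔ (f ∘ suc) (pr ∘ suc) (qs ∘ suc) i)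

¬-cong : {P Q : Set} → P ⇔ Q → (¬ P) ⇔ (¬ Q)
¬-cong pq = mk⇔ (λ ¬p q → ¬p (from pq q)) (λ ¬q p → ¬q (to pq p))

-- Traces as lists of states, and CTL* on them

module _ {k n : ℕ} (K : Kripke k n) where
  open Kripke K
  open Trace

  Path : Fin n → List (Fin n) → Set
  Path s []      = ⊤
  Path s (t ∷ w) = δ s t ≡ true × Path t w

  toTrace : ∀ s w → Path s w → Trace K
  toTrace s w p = record { len = length w ; st = List.lookup (s ∷ w) ; ok = step s w p }
    where
    step : ∀ s w → Path s w → (i : Fin (length w)) →
           δ (List.lookup (s ∷ w) (inject₁ i)) (List.lookup (s ∷ w) (suc i)) ≡ true
    step s (t ∷ w) (e , p) zero    = e
    step s (t ∷ w) (e , p) (suc i) = step t w p i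

  path-after : (ρ : Trace K) (i : Pos K ρ) → Path (st ρ i) (after (st ρ) i)
  path-after ρ = go (len ρ) (st ρ) (Trace.ok ρ)
    where
    go : ∀ m (f : Fin (suc m) → Fin n) → (∀ i → δ (f (inject₁ i)) (f (suc i)) ≡ true) →
         ∀ i → Path (f i) (after f i)
    go zero    f e zero    = tt
    go (suc m) f e zero    = e zero , go m (f ∘ suc) (e ∘ suc) zero
    go (suc m) f e (suc i) = go m (f ∘ suc) (e ∘ suc) i

  record Extension (ρ : Trace K) (i : Pos K ρ) (w : List (Fin n)) : Set where
    field
      trace   : Trace K
      start   : st trace zero ≡ st ρ zero
      agree   : AgreeUpTo K ρ trace (toℕ i)
      pos     : Pos K trace
      toℕ-pos : toℕ pos ≡ toℕ i
      ≡here   : st trace pos ≡ st ρ i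
      ≡after  : after (st trace) pos ≡ w

  extend : (ρ : Trace K) (i : Pos K ρ) (w : List (Fin n)) → Path (st ρ i) w → Extension ρ i w
  extend ρ i w p = go (glue (len ρ) (st ρ) (ok ρ) i p)
    where
    glue : ∀ m (f : Fin (suc m) → Fin n) → (∀ j → δ (f (inject₁ j)) (f (suc j)) ≡ true) →
           ∀ i → Path (f i) w →
           Σ[ v ∈ List (Fin n) ] Path (f zero) v × f zero ∷ v ≡ before f i ++ f i ∷ w
    glue m       f e zero    p = w , p , refl
    glue (suc m) f e (suc i) p with glue m (f ∘ suc) (e ∘ suc) i p
    ... | v , q , eq = f (suc zero) ∷ v , (e zero , q) , cong (f zero ∷_) eq

    go : (Σ[ v ∈ List (Fin n) ] Path (st ρ zero) v × st ρ zero ∷ v ≡ before (st ρ) i ++ st ρ i ∷ w) →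
         Extension ρ i w
    go (v , q , eq) with locate (List.lookup (st ρ zero ∷ v)) (before (st ρ) i)
                           (trans (tabulate-lookup (st ρ zero ∷ v)) eq)
    ... | splitAt j b h a = record
      { trace = toTrace (st ρ zero) v q ; start = refl
      ; agree = before⇒agree (st ρ) (List.lookup (st ρ zero ∷ v)) i j (sym b) (sym h)
      ; pos = j
      ; toℕ-pos = trans (sym (length-before (List.lookup (st ρ zero ∷ v)) j))
                    (trans (cong length b) (length-before (st ρ) i))
      ; ≡here = h ; ≡after = a }

  satL : CForm k → Fin n → List (Fin n) → Set
  satL ⊤c        s w = ⊤
  satL (atom p)  s w = μ s p ≡ true
  satL (¬c φ)    s w = ¬ satL φ s w
  satL (φ ∧c ψ)  s w = satL φ s w × satL ψ s w
  satL (Xc φ)    s w = Next (satL φ) s w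
  satL (φ Uc ψ)  s w = Until (satL φ) (satL ψ) s w
  satL (∃fc φ)   s w = Σ[ v ∈ List (Fin n) ] Path s v × satL φ s v

  -- CTL* has no past, so the suffix from `i` on determines the truth value.
  satC⇔satL : ∀ φ (ρ : Trace K) i → satC K ρ i φ ⇔ satL φ (st ρ i) (after (st ρ) i)
  satC⇔satL ⊤c       ρ i = ⇔.refl
  satC⇔satL (atom p) ρ i = ⇔.refl
  satC⇔satL (¬c φ)   ρ i = ¬-cong (satC⇔satL φ ρ i)
  satC⇔satL (φ ∧c ψ) ρ i = satC⇔satL φ ρ i ×-⇔ satC⇔satL ψ ρ i
  satC⇔satL (Xc φ)   ρ i = next⇔ (st ρ) (satC⇔satL φ ρ) i
  satC⇔satL (φ Uc ψ) ρ i = until⇔ (st ρ) (satC⇔satL φ ρ) (satC⇔satL ψ ρ) i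
  satC⇔satL (∃fc φ)  ρ i = mk⇔
    (λ (ρ′ , eq , h) → after (st {K = K} ρ′) zero ,
      subst (λ s → Path s (after (st {K = K} ρ′) zero)) eq (path-after ρ′ zero) ,
      subst (λ s → satL φ s (after (st {K = K} ρ′) zero)) eq (to (satC⇔satL φ ρ′ zero) h))
    (λ (v , p , h) → toTrace (st ρ i) v p , refl ,
      from (satC⇔satL φ (toTrace (st ρ i) v p) zero)
        (subst (satL φ (st ρ i)) (sym (tabulate-lookup v)) h))

-- Labelling the states by finitely many letters, uniformly in the Kripke structure

_reflects_ : Bool → Set → Set
b reflects P = P ⇔ (b ≡ true)

reflects-≡ : {a b : Bool} {P : Set} → a ≡ b → a reflects P → b reflects P
reflects-≡ refl r = r

reflects-dec : {b : Bool} {P : Set} → b reflects P → Dec P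
reflects-dec {true}  r = yes (from r refl)
reflects-dec {false} r = no (λ p → contradiction (to r p) λ ())

does-reflects : {P : Set} (P? : Dec P) → does P? reflects P
does-reflects (yes p) = mk⇔ (λ _ → refl) (λ _ → p)
does-reflects (no ¬p) = mk⇔ (λ p → contradiction p ¬p) (λ ())

reflects-not : {b : Bool} {P : Set} → b reflects P → not b reflects (¬ P)
reflects-not {true}  r = mk⇔ (λ ¬p → contradiction (from r refl) ¬p) (λ ())
reflects-not {false} r = mk⇔ (λ _ → refl) (λ _ p → contradiction (to r p) λ ())

reflects-∧ : {a b : Bool} {P Q : Set} → a reflects P → b reflects Q → (a ∧ b) reflects (P × Q)
reflects-∧ {true}  r s = mk⇔ (λ (_ , q) → to s q) (λ e → from r refl , from s e)
reflects-∧ {false} r s = mk⇔ (λ (p , _) → to r p) (λ ())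

reflects-∨ : {a b : Bool} {P Q : Set} → a reflects P → b reflects Q → (a ∨ b) reflects (P ⊎ Q)
reflects-∨ {true}  r s = mk⇔ (λ _ → refl) (λ _ → inj₁ (from r refl))
reflects-∨ {false} r s =
  mk⇔ (λ { (inj₁ p) → contradiction (to r p) λ () ; (inj₂ q) → to s q }) (λ e → inj₂ (from s e))

∨-∧-false : ∀ x y → x ∨ (y ∧ false) ≡ x
∨-∧-false x y = trans (cong (x ∨_) (∧-zeroʳ y)) (∨-identityʳ x)

module _ {k : ℕ} where
  -- The formula `θ a` is fixed while `lab` may inspect the structure. As `ok` ranges over every
  -- continuation `w`, each `θ a` is a state formula.
  record Labelling (A : Set) : Set where
    field
      finite : Finite A
      θ      : A → CForm k
      lab    : ∀ {n} → Kripke k n → Fin n → A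
      ok     : ∀ {n} (K : Kripke k n) s w a → satL K (θ a) s w ⇔ (lab K s ≡ a)

  open Labelling

  trivialLabelling : Labelling ⊤
  trivialLabelling = record
    { finite = 1 , ↔-sym 1↔⊤
    ; θ = λ _ → ⊤c ; lab = λ _ _ → tt ; ok = λ _ _ _ _ → mk⇔ (λ _ → refl) (λ _ → tt) }

  boolLabelling : (φ : CForm k) (b : ∀ {n} → Kripke k n → Fin n → Bool) →
                  (∀ {n} (K : Kripke k n) s w → b K s reflects satL K φ s w) → Labelling Bool
  boolLabelling φ b refl′ = record
    { finite = 2 , ↔-sym 2↔Bool ; θ = λ { true → φ ; false → ¬c φ } ; lab = b
    ; ok = λ { K s w true → refl′ K s w
             ; K s w false → ⇔.trans (reflects-not (refl′ K s w)) (not-true (b K s)) } }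
    where
    not-true : ∀ b → (not b ≡ true) ⇔ (b ≡ false)
    not-true true  = mk⇔ (λ ()) (λ ())
    not-true false = mk⇔ (λ _ → refl) (λ _ → refl)

  _×-label_ : ∀ {A B} → Labelling A → Labelling B → Labelling (A × B)
  L ×-label M = record
    { finite = fin× (finite L) (finite M)
    ; θ = λ (a , b) → θ L a ∧c θ M b
    ; lab = λ K s → lab L K s , lab M K s
    ; ok = λ K s w (a , b) → ⇔.trans (ok L K s w a ×-⇔ ok M K s w b)
        (mk⇔ (λ (e , e′) → cong₂ _,_ e e′) (λ e → cong proj₁ e , cong proj₂ e)) }

  infixr 5 _∨c_
  _∨c_ : CForm k → CForm k → CForm k
  φ ∨c ψ = ¬c (¬c φ ∧c ¬c ψ)

  reflects-∨c : ∀ {n} (K : Kripke k n) {a b} φ ψ {s w} → a reflects satL K φ s w → b reflects satL K ψ s w →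
                (a ∨ b) reflects satL K (φ ∨c ψ) s w
  reflects-∨c K {a} {b} φ ψ r t =
    reflects-≡ (deMorgan a b) (reflects-not (reflects-∧ (reflects-not r) (reflects-not t)))
    where
    deMorgan : ∀ a b → not (not a ∧ not b) ≡ a ∨ b
    deMorgan true  b     = refl
    deMorgan false true  = refl
    deMorgan false false = refl

  -- Unlike LTL A, CTL* has no empty words, so the truth value of an LTL formula
  -- at the empty word is built into the translation.
  module FromLTL {A : Set} (L : Labelling A) where
    open Enum (finite L) using (decEq)
    open Semantics decEq

    final : CForm k
    final = ¬c (Xc ⊤c)

    nextC : Bool → CForm k → CForm k
    -- If the formula holds on the empty word, its `next` holds at the last state: this is the weak
    -- next.
    nextC atEnd φ = if atEnd then ¬c (Xc (¬c φ)) else Xc φ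

    untilC : Bool → CForm k → CForm k → CForm k
    -- An until fulfilled only on the empty suffix means that `φ` holds up to and including the last
    -- state.
    untilC atEnd φ ψ = if atEnd then φ Uc (ψ ∨c (φ ∧c final)) else φ Uc ψ

    toC : LTL A → CForm k
    toC top         = ⊤c
    toC (letter a)  = θ L a
    toC (neg φ)     = ¬c (toC φ)
    toC (φ and ψ)   = toC φ ∧c toC ψ
    toC (next φ)    = nextC (sat φ []) (toC φ)
    toC (φ until ψ) = untilC (sat ψ []) (toC φ) (toC ψ)

    module _ {n} (K : Kripke k n) where
      labs : List (Fin n) → List A
      labs = map (lab L K)

      nextC-ok : ∀ φ → (∀ s w → sat φ (labs (s ∷ w)) reflects satL K (toC φ) s w) →
                 ∀ e → e ≡ sat φ [] → ∀ s w →
                 sat (next φ) (labs (s ∷ w)) reflects satL K (nextC e (toC φ)) s w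
      nextC-ok φ r true  eq s []      = reflects-≡ eq (mk⇔ (λ _ → refl) (λ _ ()))
      nextC-ok φ r true  eq s (t ∷ w) = reflects-≡ (not-involutive _) (reflects-not (reflects-not (r t w)))
      nextC-ok φ r false eq s []      = reflects-≡ eq (mk⇔ (λ ()) (λ ()))
      nextC-ok φ r false eq s (t ∷ w) = r t w

      untilC-ok : ∀ φ ψ → (∀ s w → sat φ (labs (s ∷ w)) reflects satL K (toC φ) s w) →
                  (∀ s w → sat ψ (labs (s ∷ w)) reflects satL K (toC ψ) s w) →
                  ∀ e → e ≡ sat ψ [] → ∀ s w →
                  sat (φ until ψ) (labs (s ∷ w)) reflects satL K (untilC e (toC φ) (toC ψ)) s w
      untilC-ok φ ψ r r′ true eq s [] =
        reflects-∨c K (toC ψ) (toC φ ∧c final) (r′ s [])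
          (reflects-∧ (r s []) (reflects-≡ eq (mk⇔ (λ _ → refl) (λ _ ()))))
      untilC-ok φ ψ r r′ true eq s (t ∷ w) =
        reflects-∨ (reflects-≡ (∨-∧-false (sat ψ (labs (s ∷ t ∷ w))) (sat φ (labs (s ∷ t ∷ w))))
              (reflects-∨c K (toC ψ) (toC φ ∧c final) (r′ s (t ∷ w))
                (reflects-∧ {b = false} (r s (t ∷ w)) (mk⇔ (λ ¬t → ⊥-elim (¬t tt)) (λ ())))))
          (reflects-∧ (r s (t ∷ w)) (untilC-ok φ ψ r r′ true eq t w))
      untilC-ok φ ψ r r′ false eq s [] =
        reflects-≡ (trans (sym (∨-∧-false _ (sat φ (labs (s ∷ [])))))
                     (cong (λ e → sat ψ (labs (s ∷ [])) ∨ (sat φ (labs (s ∷ [])) ∧ e)) eq)) (r′ s [])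
      untilC-ok φ ψ r r′ false eq s (t ∷ w) =
        reflects-∨ (r′ s (t ∷ w)) (reflects-∧ (r s (t ∷ w)) (untilC-ok φ ψ r r′ false eq t w))

      toC-ok : ∀ φ s w → sat φ (labs (s ∷ w)) reflects satL K (toC φ) s w
      toC-ok top         s w = mk⇔ (λ _ → refl) (λ _ → tt)
      toC-ok (letter a)  s w = ⇔.trans (ok L K s w a) (does-reflects (decEq (lab L K s) a))
      toC-ok (neg φ)     s w = reflects-not (toC-ok φ s w)
      toC-ok (φ and ψ)   s w = reflects-∧ (toC-ok φ s w) (toC-ok ψ s w)
      toC-ok (next φ)    s w = nextC-ok φ (toC-ok φ) (sat φ []) refl s w
      toC-ok (φ until ψ) s w = untilC-ok φ ψ (toC-ok φ) (toC-ok ψ) (sat ψ []) refl s w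

-- Automata on words whose positions are marked by pointers

Marks : Set
Marks = ℕ → Bool

-- Pointers are numbered as de Bruijn indices: a quantifier pushes a new pointer 0 and shifts the
-- others.
_▸_ : {X : Set} → X → (ℕ → X) → ℕ → X
(x ▸ v) zero    = x
(x ▸ v) (suc y) = v y

infixr 5 _▸_

-- `j` is the position of the first letter. A pointer outside the word leaves no mark.
mark : (ℕ → ℕ) → ℕ → List A → List (A × Marks)
mark v j []      = []
mark v j (a ∷ w) = (a , λ x → v x ≡ᵇ j) ∷ mark v (suc j) w

-- Counter-freeness is demanded for all sequences of marked letters, even with one pointer at
-- several positions, because the powers of a word repeat its marks. Marks are functions, so `ext`
-- asks that `δ` respect pointwise equality.
record Automaton (A : Set) : Set₁ where
  field
    {State}   : Set
    finite    : Finite State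
    δ         : A × Marks → State → State
    ext       : ∀ a {m m′} → m ≗ m′ → ∀ q → δ (a , m) q ≡ δ (a , m′) q
    bound     : ℕ
    aperiodic : ∀ u → Stable (run δ u) bound

  unmarked : A → State → State
  unmarked a = δ (a , const false)

open Automaton

≡ᵇ-refl : ∀ n → (n ≡ᵇ n) ≡ true
≡ᵇ-refl zero    = refl
≡ᵇ-refl (suc n) = ≡ᵇ-refl n

≢⇒≡ᵇ-false : ∀ m n → m ≢ n → (m ≡ᵇ n) ≡ false
≢⇒≡ᵇ-false zero    zero    ne = contradiction refl ne
≢⇒≡ᵇ-false zero    (suc n) ne = refl
≢⇒≡ᵇ-false (suc m) zero    ne = refl
≢⇒≡ᵇ-false (suc m) (suc n) ne = ≢⇒≡ᵇ-false m n (ne ∘ cong suc)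

run-unmarked : (D : Automaton A) → ∀ {v j} → (∀ y → v y < j) → ∀ w q →
               run (δ D) (mark v j w) q ≡ run (unmarked D) w q
run-unmarked D lt []      q = refl
run-unmarked D {v} {j} lt (a ∷ w) q =
  trans (cong (run (δ D) (mark v (suc j) w)) (ext D a (λ y → ≢⇒≡ᵇ-false (v y) j (<⇒≢ (lt y))) q))
        (run-unmarked D (λ y → m≤n⇒m≤1+n (lt y)) w _)

mark-++ : ∀ v j (u w : List A) → mark v j (u ++ w) ≡ mark v j u ++ mark v (j + length u) w
mark-++ v j []      w rewrite +-identityʳ j = refl
mark-++ v j (a ∷ u) w rewrite +-suc j (length u) = cong (_ ∷_) (mark-++ v (suc j) u w)

pullback : (f : B → A) (σ : ℕ → ℕ) → Automaton A → Automaton B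
pullback f σ D = record
  { finite = finite D
  ; δ = λ (b , m) → δ D (f b , m ∘ σ)
  ; ext = λ b eq → ext D (f b) (eq ∘ σ)
  ; bound = bound D
  ; aperiodic = λ u → stable-sim id id (run-map (δ D) (λ (b , m) → f b , m ∘ σ) u) (bound D)
                        (aperiodic D (map _ u)) }

run-pullback : (f : B → A) (σ : ℕ → ℕ) (D : Automaton A) → ∀ v j w q →
               run (δ (pullback f σ D)) (mark v j w) q ≡ run (δ D) (mark (v ∘ σ) j (map f w)) q
run-pullback f σ D v j []      q = refl
run-pullback f σ D v j (b ∷ w) q = run-pullback f σ D v (suc j) w _

_⊗_ : Automaton A → Automaton A → Automaton A
D ⊗ E = record
  { finite = fin× (finite D) (finite E)
  ; δ = λ a (p , q) → δ D a p , δ E a q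
  ; ext = λ a eq (p , q) → cong₂ _,_ (ext D a eq p) (ext E a eq q)
  ; bound = bound D + bound E
  ; aperiodic = λ u x → cong₂ _,_
      (stable-image proj₁ (run-sim proj₁ (λ _ _ → refl) u) (bound D + bound E)
        (stable-≥ (run (δ D) u) (m≤m+n (bound D) (bound E)) (aperiodic D u)) x)
      (stable-image proj₂ (run-sim proj₂ (λ _ _ → refl) u) (bound D + bound E)
        (stable-+ (run (δ E) u) (bound E) (bound D) (aperiodic E u)) x) }

-- Guessing the position of a pointer by a subset construction

module Guess {A : Set} (D : Automaton A) where
  open Enum (finite D) using (size; enc; dec; enc-dec; dec-enc; decEq)

  Subset : Set
  Subset = Vec Bool size

  _∈ₛ_ : State D → Subset → Set
  s ∈ₛ X = lookup X (enc s) ≡ true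

  comprehension : {P : State D → Set} → (∀ s → Dec (P s)) → Subset
  comprehension P? = tabulate (λ i → does (P? (dec i)))

  ∈-comprehension : ∀ {P : State D → Set} (P? : ∀ s → Dec (P s)) s → (s ∈ₛ comprehension P?) ⇔ P s
  ∈-comprehension {P} P? s = ⇔.trans
    (mk⇔ (trans (sym eq)) (trans eq))
    (⇔.trans (⇔.sym (does-reflects (P? (dec (enc s)))))
      (mk⇔ (subst P (dec-enc s)) (subst P (sym (dec-enc s)))))
    where
    eq : lookup (comprehension P?) (enc s) ≡ does (P? (dec (enc s)))
    eq = lookup∘tabulate _ (enc s)

  subset-ext : ∀ {X Y} → (∀ s → (s ∈ₛ X) ⇔ (s ∈ₛ Y)) → X ≡ Y
  subset-ext {X} {Y} eq = trans (sym (tabulate∘lookup X)) (trans (tabulate-cong at) (tabulate∘lookup Y))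
    where
    bool-ext : ∀ {a b} → (a ≡ true) ⇔ (b ≡ true) → a ≡ b
    bool-ext {true}  e = sym (to e refl)
    bool-ext {false} {true}  e = from e refl
    bool-ext {false} {false} e = refl
    at : lookup X ≗ lookup Y
    at i = subst (λ i → lookup X i ≡ lookup Y i) (enc-dec i) (bool-ext (eq (dec i)))

  some? : {P : State D → Set} → (∀ s → Dec (P s)) → Dec (Σ[ s ∈ State D ] P s)
  some? {P} P? = map′ (λ (i , p) → dec i , p) (λ (s , p) → enc s , subst P (sym (dec-enc s)) p)
                   (any? (P? ∘ dec))

  Image : (State D → State D) → Subset → State D → Set
  Image f X t = Σ[ s ∈ State D ] (s ∈ₛ X) × f s ≡ t

  image? : ∀ f X t → Dec (Image f X t)
  image? f X t = some? (λ s → (lookup X (enc s) ≟ᵇ true) ×-dec decEq (f s) t)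

  δ₀ δ₁ : A × Marks → State D → State D
  δ₀ (a , m) = δ D (a , false ▸ m)
  δ₁ (a , m) = δ D (a , true ▸ m)

  stepSet? : ∀ a q X t → Dec (Image (δ₀ a) X t ⊎ δ₁ a q ≡ t)
  stepSet? a q X t = image? (δ₀ a) X t ⊎-dec decEq (δ₁ a q) t

  -- `q` is the state reached while the pointer is not yet placed, `X` the set of states reached
  -- with the pointer placed at some position already read.
  δᴳ : A × Marks → State D × Subset → State D × Subset
  δᴳ a (q , X) = δ₀ a q , comprehension (stepSet? a q X)

  run₀ : List (A × Marks) → State D → State D
  run₀ = run δ₀

  -- t is reached from q by reading u with the pointer at one of its positions.
  Guessed : List (A × Marks) → State D → State D → Set
  Guessed []      q t = ⊥
  Guessed (a ∷ u) q t = run₀ u (δ₁ a q) ≡ t ⊎ Guessed u (δ₀ a q) t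

  run₁ : ∀ u x → proj₁ (run δᴳ u x) ≡ run₀ u (proj₁ x)
  run₁ = run-sim proj₁ (λ _ _ → refl)

  ∈-run : ∀ u q X t → (t ∈ₛ proj₂ (run δᴳ u (q , X))) ⇔ (Image (run₀ u) X t ⊎ Guessed u q t)
  ∈-run [] q X t = mk⇔ (λ t∈ → inj₁ (t , t∈ , refl)) (λ { (inj₁ (s , s∈ , refl)) → s∈ })
  ∈-run (a ∷ u) q X t = ⇔.trans (∈-run u (δ₀ a q) X′ t) (mk⇔ fwd bwd)
    where
    X′ : Subset
    X′ = comprehension (stepSet? a q X)
    ∈X′ : ∀ s → (s ∈ₛ X′) ⇔ (Image (δ₀ a) X s ⊎ δ₁ a q ≡ s)
    ∈X′ = ∈-comprehension (stepSet? a q X)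
    fwd : Image (run₀ u) X′ t ⊎ Guessed u (δ₀ a q) t → Image (run₀ (a ∷ u)) X t ⊎ Guessed (a ∷ u) q t
    fwd (inj₂ g) = inj₂ (inj₂ g)
    fwd (inj₁ (s , s∈ , eq)) with to (∈X′ s) s∈
    ... | inj₁ (r , r∈ , refl) = inj₁ (r , r∈ , eq)
    ... | inj₂ refl            = inj₂ (inj₁ eq)
    bwd : Image (run₀ (a ∷ u)) X t ⊎ Guessed (a ∷ u) q t → Image (run₀ u) X′ t ⊎ Guessed u (δ₀ a q) t
    bwd (inj₁ (r , r∈ , eq)) = inj₁ (_ , from (∈X′ _) (inj₁ (r , r∈ , refl)) , eq)
    bwd (inj₂ (inj₁ eq))     = inj₁ (_ , from (∈X′ _) (inj₂ refl) , eq)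
    bwd (inj₂ (inj₂ g))      = inj₂ g

  -- t is reached by reading uⁿ with the pointer inside one of the n copies of u,
  -- which is preceded by i and followed by j copies.
  GuessedPower : List (A × Marks) → ℕ → State D → State D → Set
  GuessedPower u n q t = Σ[ i ∈ ℕ ] Σ[ j ∈ ℕ ] (suc (i + j) ≡ n) ×
    (Σ[ s ∈ State D ] Guessed u (iter (run₀ u) i q) s × iter (run₀ u) j s ≡ t)

  ∈-iter : ∀ u n q X t → (t ∈ₛ proj₂ (iter (run δᴳ u) n (q , X))) ⇔
           (Image (iter (run₀ u) n) X t ⊎ GuessedPower u n q t)
  ∈-iter u zero q X t =
    mk⇔ (λ t∈ → inj₁ (t , t∈ , refl)) (λ { (inj₁ (s , s∈ , refl)) → s∈ ; (inj₂ (_ , _ , () , _)) })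
  ∈-iter u (suc n) q X t = ⇔.trans (∈-iter u n _ X′ t) (mk⇔ fwd bwd)
    where
    X′ : Subset
    X′ = proj₂ (run δᴳ u (q , X))
    q′ : State D
    q′ = proj₁ (run δᴳ u (q , X))
    fwd : Image (iter (run₀ u) n) X′ t ⊎ GuessedPower u n q′ t →
          Image (iter (run₀ u) (suc n)) X t ⊎ GuessedPower u (suc n) q t
    fwd (inj₁ (s , s∈ , eq)) with to (∈-run u q X s) s∈
    ... | inj₁ (r , r∈ , refl) = inj₁ (r , r∈ , eq)
    ... | inj₂ g               = inj₂ (0 , n , refl , s , g , eq)
    fwd (inj₂ (i , j , eq , s , g , eq′)) = inj₂ (suc i , j , cong suc eq , s ,
      subst (λ z → Guessed u (iter (run₀ u) i z) s) (run₁ u (q , X)) g , eq′)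
    bwd : Image (iter (run₀ u) (suc n)) X t ⊎ GuessedPower u (suc n) q t →
          Image (iter (run₀ u) n) X′ t ⊎ GuessedPower u n q′ t
    bwd (inj₁ (r , r∈ , eq)) = inj₁ (_ , from (∈-run u q X _) (inj₁ (r , r∈ , refl)) , eq)
    bwd (inj₂ (zero , j , refl , s , g , eq)) = inj₁ (s , from (∈-run u q X s) (inj₂ g) , eq)
    bwd (inj₂ (suc i , j , eq , s , g , eq′)) = inj₂ (i , j , suc-injective eq , s ,
      subst (λ z → Guessed u (iter (run₀ u) i z) s) (sym (run₁ u (q , X))) g , eq′)

  run₀-stable : ∀ u → Stable (run₀ u) (bound D)
  run₀-stable u = stable-sim id id (run-map (δ D) (λ (a , m) → a , false ▸ m) u) (bound D)
                    (aperiodic D (map _ u))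

  -- Besides the copy that contains the pointer there are 2N others, so on one side of it there are
  -- at least N, enough to absorb a further copy.
  boundᴳ : ℕ
  boundᴳ = suc (bound D + bound D)

  -- In uⁿ with n > 2N + 1 copies, more than N copies are on the same side of the guessed one.
  guessedPower-stable : ∀ u q t → GuessedPower u boundᴳ q t ⇔ GuessedPower u (suc boundᴳ) q t
  guessedPower-stable u q t = mk⇔ fwd bwd
    where
    N = bound D
    stable : ∀ {M} → N ≤ M → Stable (run₀ u) M
    stable le = stable-≥ (run₀ u) le (run₀-stable u)
    fwd : GuessedPower u boundᴳ q t → GuessedPower u (suc boundᴳ) q t
    fwd (i , j , eq , s , g , eq′) with N ≤? i
    ... | yes N≤i = suc i , j , cong suc eq , s , subst (λ z → Guessed u z s) (stable N≤i q) g , eq′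
    ... | no  N≰i with N ≤? j
    ...   | yes N≤j = i , suc j , cong suc (trans (+-suc i j) eq) , s , g , trans (sym (stable N≤j s)) eq′
    ...   | no  N≰j = contradiction (+-mono-< (≰⇒> N≰i) (≰⇒> N≰j)) (<-irrefl (suc-injective eq))
    bwd : GuessedPower u (suc boundᴳ) q t → GuessedPower u boundᴳ q t
    bwd (i , j , eq , s , g , eq′) with suc N ≤? i
    bwd (suc i , j , eq , s , g , eq′) | yes (s≤s N≤i) =
      i , j , suc-injective eq , s , subst (λ z → Guessed u z s) (sym (stable N≤i q)) g , eq′
    ... | no  N≮i with suc N ≤? j
    bwd (i , suc j , eq , s , g , eq′) | no N≮i | yes (s≤s N≤j) =
      i , j , trans (sym (+-suc i j)) (suc-injective eq) , s , g , trans (stable N≤j s) eq′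
    ...   | no  N≮j = contradiction
              (subst (_≤ N + N) (suc-injective eq) (+-mono-≤ (≤-pred (≰⇒> N≮i)) (≤-pred (≰⇒> N≮j)))) 1+n≰n

  guess : Automaton A
  guess = record
    { finite = fin× (finite D) (finVec (2 , ↔-sym 2↔Bool) size)
    ; δ = δᴳ
    ; ext = λ a eq (q , X) → cong₂ _,_ (ext D a (▸-cong eq) q)
        (subset-ext λ s → ⇔.trans (∈-comprehension (stepSet? (a , _) q X) s)
          (⇔.trans (step-ext a eq q X s) (⇔.sym (∈-comprehension (stepSet? (a , _) q X) s))))
    ; bound = boundᴳ
    ; aperiodic = λ u (q , X) → cong₂ _,_ (stable₁ u (q , X))
        (subset-ext λ t → ⇔.trans (∈-iter u boundᴳ q X t)
          (⇔.trans (image-stable u X t ⊎-⇔ guessedPower-stable u q t) (⇔.sym (∈-iter u (suc boundᴳ) q X t)))) }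
    where
    ▸-cong : ∀ {b : Bool} {m m′ : Marks} → m ≗ m′ → (b ▸ m) ≗ (b ▸ m′)
    ▸-cong eq zero    = refl
    ▸-cong eq (suc y) = eq y

    step-ext : ∀ a {m m′} → m ≗ m′ → ∀ q X s →
      (Image (δ₀ (a , m)) X s ⊎ δ₁ (a , m) q ≡ s) ⇔ (Image (δ₀ (a , m′)) X s ⊎ δ₁ (a , m′) q ≡ s)
    step-ext a eq q X s =
      mk⇔ (λ (r , r∈ , e) → r , r∈ , trans (sym (ext D a (▸-cong eq) r)) e)
          (λ (r , r∈ , e) → r , r∈ , trans (ext D a (▸-cong eq) r) e)
      ⊎-⇔ mk⇔ (trans (sym (ext D a (▸-cong eq) q))) (trans (ext D a (▸-cong eq) q))

    N≤boundᴳ : bound D ≤ boundᴳ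
    N≤boundᴳ = m≤n⇒m≤1+n (m≤m+n (bound D) (bound D))

    stable₀ : ∀ u → Stable (run₀ u) boundᴳ
    stable₀ u = stable-≥ (run₀ u) N≤boundᴳ (run₀-stable u)

    stable₁ : ∀ u x → proj₁ (iter (run δᴳ u) boundᴳ x) ≡ proj₁ (iter (run δᴳ u) (suc boundᴳ) x)
    stable₁ u = stable-image proj₁ (run₁ u) boundᴳ (stable₀ u)

    image-stable : ∀ u X t → Image (iter (run₀ u) boundᴳ) X t ⇔ Image (iter (run₀ u) (suc boundᴳ)) X t
    image-stable u X t = mk⇔ (λ (s , s∈ , e) → s , s∈ , trans (sym (stable₀ u s)) e)
                             (λ (s , s∈ , e) → s , s∈ , trans (stable₀ u s) e)

  run-past : ∀ v p j w q → p < j → run (δ D) (mark (p ▸ v) j w) q ≡ run₀ (mark v j w) q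
  run-past v p j []      q lt = refl
  run-past v p j (a ∷ w) q lt =
    trans (cong (run (δ D) (mark (p ▸ v) (suc j) w))
             (ext D a (λ { zero → ≢⇒≡ᵇ-false p j (<⇒≢ lt) ; (suc y) → refl }) q))
          (run-past v p (suc j) w _ (m≤n⇒m≤1+n lt))

  guessed⇔ : ∀ v j w q t → Guessed (mark v j w) q t ⇔
             (Σ[ p ∈ ℕ ] p < length w × run (δ D) (mark (j + p ▸ v) j w) q ≡ t)
  guessed⇔ v j []      q t = mk⇔ (λ ()) (λ { (_ , () , _) })
  guessed⇔ v j (a ∷ w) q t = ⇔.trans (⇔.refl ⊎-⇔ guessed⇔ v (suc j) w _ t) (mk⇔ fwd bwd)
    where
    m : Marks
    m y = v y ≡ᵇ j
    at-head : run (δ D) (mark (j + 0 ▸ v) j (a ∷ w)) q ≡ run₀ (mark v (suc j) w) (δ₁ (a , m) q)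
    at-head rewrite +-identityʳ j =
      trans (cong (run (δ D) (mark (j ▸ v) (suc j) w))
              (ext D a (λ { zero → ≡ᵇ-refl j ; (suc y) → refl }) q))
            (run-past v j (suc j) w _ (n<1+n j))
    at-tail : ∀ p → run (δ D) (mark (j + suc p ▸ v) j (a ∷ w)) q ≡
                  run (δ D) (mark (suc j + p ▸ v) (suc j) w) (δ₀ (a , m) q)
    at-tail p rewrite +-suc j p =
      cong (run (δ D) (mark (suc (j + p) ▸ v) (suc j) w))
        (ext D a (λ { zero → ≢⇒≡ᵇ-false (suc (j + p)) j (λ e → <⇒≢ (s≤s (m≤m+n j p)) (sym e))
                    ; (suc y) → refl }) q)
    fwd : run₀ (mark v (suc j) w) (δ₁ (a , m) q) ≡ t ⊎
          (Σ[ p ∈ ℕ ] p < length w × run (δ D) (mark (suc j + p ▸ v) (suc j) w) (δ₀ (a , m) q) ≡ t) →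
          Σ[ p ∈ ℕ ] p < length (a ∷ w) × run (δ D) (mark (j + p ▸ v) j (a ∷ w)) q ≡ t
    fwd (inj₁ e)            = 0 , s≤s z≤n , trans at-head e
    fwd (inj₂ (p , lt , e)) = suc p , s≤s lt , trans (at-tail p) e
    bwd : (Σ[ p ∈ ℕ ] p < length (a ∷ w) × run (δ D) (mark (j + p ▸ v) j (a ∷ w)) q ≡ t) →
          run₀ (mark v (suc j) w) (δ₁ (a , m) q) ≡ t ⊎
          (Σ[ p ∈ ℕ ] p < length w × run (δ D) (mark (suc j + p ▸ v) (suc j) w) (δ₀ (a , m) q) ≡ t)
    bwd (zero  , _ , e)      = inj₁ (trans (sym at-head) e)
    bwd (suc p , s≤s lt , e) = inj₂ (p , lt , trans (sym (at-tail p)) e)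

  module _ (start : State D) (accept : State D → Bool) where
    startᴳ : State D × Subset
    startᴳ = start , replicate size false

    accept? : (x : State D × Subset) → Dec (Σ[ s ∈ State D ] (s ∈ₛ proj₂ x) × accept s ≡ true)
    accept? (q , X) = some? (λ s → (lookup X (enc s) ≟ᵇ true) ×-dec (accept s ≟ᵇ true))

    acceptᴳ : State D × Subset → Bool
    acceptᴳ x = does (accept? x)

    acceptᴳ-correct : ∀ v w → acceptᴳ (run δᴳ (mark v 0 w) startᴳ) reflects
      (Σ[ p ∈ ℕ ] p < length w × accept (run (δ D) (mark (p ▸ v) 0 w) start) ≡ true)
    acceptᴳ-correct v w = ⇔.trans (mk⇔ fwd bwd) (does-reflects (accept? (run δᴳ (mark v 0 w) startᴳ)))
      where
      ∉-empty : ∀ {f : State D → State D} {t} → ¬ Image f (replicate size false) t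
      ∉-empty (s , s∈ , _) with trans (sym (lookup-replicate (enc s) false)) s∈
      ... | ()
      final : State D × Subset
      final = run δᴳ (mark v 0 w) startᴳ
      fwd : (Σ[ p ∈ ℕ ] p < length w × accept (run (δ D) (mark (p ▸ v) 0 w) start) ≡ true) →
            Σ[ s ∈ State D ] (s ∈ₛ proj₂ final) × accept s ≡ true
      fwd (p , lt , e) = _ ,
        from (∈-run (mark v 0 w) start (replicate size false) _)
          (inj₂ (from (guessed⇔ v 0 w start _) (p , lt , refl))) , e
      bwd : (Σ[ s ∈ State D ] (s ∈ₛ proj₂ final) × accept s ≡ true) →
            Σ[ p ∈ ℕ ] p < length w × accept (run (δ D) (mark (p ▸ v) 0 w) start) ≡ true
      bwd (s , s∈ , e) with to (∈-run (mark v 0 w) start (replicate size false) s) s∈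
      ... | inj₁ im = ⊥-elim (∉-empty im)
      ... | inj₂ g with to (guessed⇔ v 0 w start s) g
      ...   | p , lt , refl = p , lt , e

-- Reading up to pointer 0

module Freeze {A : Set} (D : Automaton A) (out : A → State D → Bool) where
  δᶠ : A × Marks → State D ⊎ Bool → State D ⊎ Bool
  δᶠ (a , m) (inj₁ q) = if m 0 then inj₂ (out a (δ D (a , m) q)) else inj₁ (δ D (a , m) q)
  δᶠ (a , m) (inj₂ b) = inj₂ b

  run-frozen : ∀ u b → run δᶠ u (inj₂ b) ≡ inj₂ b
  run-frozen []      b = refl
  run-frozen (_ ∷ u) b = run-frozen u b

  iter-frozen : ∀ u n b → iter (run δᶠ u) n (inj₂ b) ≡ inj₂ b
  iter-frozen u zero    b = refl
  iter-frozen u (suc n) b rewrite run-frozen u b = iter-frozen u n b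

  -- Whether `u` carries pointer 0 does not depend on the state. In the first case the bound of `D`
  -- applies, in the second one copy of `u` freezes everything; the successor in the bound of
  -- `freeze` provides this copy when `bound D` is 0.
  runs-or-freezes : ∀ u → (∀ q → run δᶠ u (inj₁ q) ≡ inj₁ (run (δ D) u q)) ⊎
                          (∀ q → Σ[ b ∈ Bool ] run δᶠ u (inj₁ q) ≡ inj₂ b)
  runs-or-freezes [] = inj₁ (λ _ → refl)
  runs-or-freezes ((a , m) ∷ u) with m 0 | runs-or-freezes u
  ... | true  | _      = inj₂ (λ q → _ , run-frozen u _)
  ... | false | inj₁ r = inj₁ (λ q → r _)
  ... | false | inj₂ r = inj₂ (λ q → r _)

  freeze : Automaton A
  freeze = record
    { finite = fin⊎ (finite D) (2 , ↔-sym 2↔Bool)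
    ; δ = δᶠ
    ; ext = ext′
    ; bound = suc (bound D)
    ; aperiodic = stable }
    where
    ext′ : ∀ a {m m′} → m ≗ m′ → ∀ q → δᶠ (a , m) q ≡ δᶠ (a , m′) q
    ext′ a eq (inj₁ q) rewrite eq 0 | ext D a eq q = refl
    ext′ a eq (inj₂ b) = refl

    stable : ∀ u → Stable (run δᶠ u) (suc (bound D))
    stable u (inj₂ b) = trans (iter-frozen u (suc (bound D)) b) (sym (iter-frozen u (suc (suc (bound D))) b))
    stable u (inj₁ q) with runs-or-freezes u
    ... | inj₁ r = trans (sym (iter-sim inj₁ (λ q → sym (r q)) (suc (bound D)) q))
                     (trans (cong inj₁ (stable-+ (run (δ D) u) (bound D) 1 (aperiodic D u) q))
                       (iter-sim inj₁ (λ q → sym (r q)) (suc (suc (bound D))) q))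
    ... | inj₂ r with r q
    ...   | b , eq rewrite eq = trans (iter-frozen u (bound D) b) (sym (iter-frozen u (suc (bound D)) b))

  acceptᶠ : State D ⊎ Bool → Bool
  acceptᶠ (inj₁ _) = false
  acceptᶠ (inj₂ b) = b

  run-never : ∀ v j w q → j + length w ≤ v 0 → run δᶠ (mark v j w) (inj₁ q) ≡ inj₁ (run (δ D) (mark v j w) q)
  run-never v j []      q le = refl
  run-never v j (a ∷ w) q le
    rewrite +-suc j (length w)
          | ≢⇒≡ᵇ-false (v 0) j (λ e → <⇒≢ (≤-trans (s≤s (m≤m+n j (length w))) le) (sym e))
    = run-never v (suc j) w _ le

  run-at : ∀ v j u a w q → v 0 ≡ j + length u →
           run δᶠ (mark v j (u ++ a ∷ w)) (inj₁ q) ≡ inj₂ (out a (run (δ D) (mark v j (u ++ a ∷ [])) q))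
  run-at v j [] a w q eq rewrite +-identityʳ j | eq | ≡ᵇ-refl j = run-frozen (mark v (suc j) w) _
  run-at v j (b ∷ u) a w q eq
    rewrite +-suc j (length u)
          | ≢⇒≡ᵇ-false (v 0) j (λ e → <⇒≢ (s≤s (m≤m+n j (length u))) (trans (sym e) eq))
    = run-at v (suc j) u a w _ eq

-- A one-bit memory for pointer 1. Stopped at pointer 0, it tells whether pointer 1 is at most
-- pointer 0, and the other order relations between pointers are built from this one.
seen : {A : Set} → Automaton A
seen {A} = record
  { finite = 2 , ↔-sym 2↔Bool
  ; δ = step
  ; ext = λ a eq s → cong (s ∨_) (eq 1)
  ; bound = 1
  ; aperiodic = idempotent }
  where
  step : A × Marks → Bool → Bool
  step (_ , m) s = s ∨ m 1
  run-true : ∀ u → run step u true ≡ true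
  run-true []      = refl
  run-true (_ ∷ u) = run-true u
  idempotent : ∀ u → Stable (run step u) 1
  idempotent u true  = sym (cong (run step u) (run-true u))
  idempotent u false with run step u false in eq
  ... | true  = sym (run-true u)
  ... | false = sym eq

run-seen : ∀ {A : Set} v j (w : List A) s →
  run (δ seen) (mark v j w) s reflects (s ≡ true ⊎ (j ≤ v 1 × v 1 < j + length w))
run-seen v j [] s = mk⇔ (λ { (inj₁ e) → e ; (inj₂ (le , lt)) →
  contradiction (subst (v 1 <_) (+-identityʳ j) lt) (λ lt → <⇒≱ lt le) }) inj₁
run-seen v j (a ∷ w) s =
  ⇔.trans (mk⇔ fwd bwd) (run-seen v (suc j) w (s ∨ (v 1 ≡ᵇ j)))
  where
  head : (s ∨ (v 1 ≡ᵇ j)) reflects (s ≡ true ⊎ v 1 ≡ j)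
  head = reflects-∨ ⇔.refl (mk⇔ (λ { refl → ≡ᵇ-refl (v 1) })
    (λ e → decidable-stable (v 1 ≟ℕ j)
      (λ ne → contradiction (trans (sym e) (≢⇒≡ᵇ-false (v 1) j ne)) λ ())))
  fwd : s ≡ true ⊎ (j ≤ v 1 × v 1 < j + length (a ∷ w)) →
        s ∨ (v 1 ≡ᵇ j) ≡ true ⊎ (suc j ≤ v 1 × v 1 < suc j + length w)
  fwd (inj₁ e) = inj₁ (to head (inj₁ e))
  fwd (inj₂ (le , lt)) with m≤n⇒m<n∨m≡n le
  ... | inj₁ j< = inj₂ (j< , subst (v 1 <_) (+-suc j (length w)) lt)
  ... | inj₂ e  = inj₁ (to head (inj₂ (sym e)))
  bwd : s ∨ (v 1 ≡ᵇ j) ≡ true ⊎ (suc j ≤ v 1 × v 1 < suc j + length w) →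
        s ≡ true ⊎ (j ≤ v 1 × v 1 < j + length (a ∷ w))
  bwd (inj₂ (j< , lt)) = inj₂ (<⇒≤ j< , subst (v 1 <_) (sym (+-suc j (length w))) lt)
  bwd (inj₁ e) with from head e
  ... | inj₁ e′  = inj₁ e′
  ... | inj₂ refl = inj₂ (≤-refl , subst (v 1 <_) (sym (+-suc (v 1) (length w))) (s≤s (m≤m+n (v 1) (length w))))

-- Recognisable predicates on traces with pointers

module _ {k : ℕ} where
  open Labelling
  open Trace

  Pred : Set₁
  Pred = ∀ {n} (K : Kripke k n) → Trace K → (ℕ → ℕ) → Set

  ∣_∣ : ∀ {n} {K : Kripke k n} → Trace K → ℕ
  ∣ ρ ∣ = suc (len ρ)

  word : ∀ {A n} → Labelling {k} A → (K : Kripke k n) → Trace K → List A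
  word L K ρ = map (lab L K) (List.tabulate (st ρ))

  length-word : ∀ {A n} (L : Labelling {k} A) (K : Kripke k n) ρ → length (word L K ρ) ≡ ∣ ρ ∣
  length-word L K ρ = trans (length-map (lab L K) (List.tabulate (st ρ))) (length-tabulate (st ρ))

  record Rec (P : Pred) : Set₁ where
    field
      {Letter}  : Set
      labelling : Labelling {k} Letter
      automaton : Automaton Letter
      start     : State automaton
      accept    : State automaton → Bool
      correct   : ∀ {n} (K : Kripke k n) ρ → Initial K ρ → ∀ v →
                  accept (run (δ automaton) (mark v 0 (word labelling K ρ)) start) reflects P K ρ v

  open Rec

  rec? : ∀ {P : Pred} → Rec P → ∀ {n} (K : Kripke k n) ρ → Initial K ρ → ∀ v → Dec (P K ρ v)
  rec? R K ρ init v = reflects-dec (correct R K ρ init v)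

  rec-cong : ∀ {P Q : Pred} → (∀ {n} (K : Kripke k n) ρ → Initial K ρ → ∀ v → P K ρ v ⇔ Q K ρ v) →
             Rec P → Rec Q
  rec-cong eq R = record
    { labelling = labelling R ; automaton = automaton R ; start = start R ; accept = accept R
    ; correct = λ K ρ init v → ⇔.trans (⇔.sym (eq K ρ init v)) (correct R K ρ init v) }

  rec-¬ : ∀ {P : Pred} → Rec P → Rec (λ K ρ v → ¬ P K ρ v)
  rec-¬ R = record
    { labelling = labelling R ; automaton = automaton R ; start = start R ; accept = not ∘ accept R
    ; correct = λ K ρ init v → reflects-not (correct R K ρ init v) }

  module _ {P Q : Pred} (R : Rec P) (S : Rec Q) where
    private
      L : Labelling {k} (Letter R × Letter S)
      L = labelling R ×-label labelling S
      D₁ D₂ : Automaton (Letter R × Letter S)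
      D₁ = pullback proj₁ id (automaton R)
      D₂ = pullback proj₂ id (automaton S)

    rec-pair : (op : Bool → Bool → Bool) {_⊙_ : Set → Set → Set} →
               (∀ {a b P Q} → a reflects P → b reflects Q → op a b reflects (P ⊙ Q)) →
               Rec (λ K ρ v → P K ρ v ⊙ Q K ρ v)
    rec-pair op r = record
      { labelling = L
      ; automaton = D₁ ⊗ D₂
      ; start = start R , start S
      ; accept = λ (p , q) → op (accept R p) (accept S q)
      ; correct = λ K ρ init v → r
          (reflects-≡ (cong (accept R) (sym (trans
              (run-sim proj₁ (λ _ _ → refl) (mark v 0 (word L K ρ)) (start R , start S))
              (trans (run-pullback proj₁ id (automaton R) v 0 (word L K ρ) (start R))
                (cong (λ u → run (δ (automaton R)) (mark v 0 u) (start R)) (sym (map-∘ (List.tabulate (st ρ)))))))))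
            (correct R K ρ init v))
          (reflects-≡ (cong (accept S) (sym (trans
              (run-sim proj₂ (λ _ _ → refl) (mark v 0 (word L K ρ)) (start R , start S))
              (trans (run-pullback proj₂ id (automaton S) v 0 (word L K ρ) (start S))
                (cong (λ u → run (δ (automaton S)) (mark v 0 u) (start S)) (sym (map-∘ (List.tabulate (st ρ)))))))))
            (correct S K ρ init v)) }

    rec-× : Rec (λ K ρ v → P K ρ v × Q K ρ v)
    rec-× = rec-pair _∧_ reflects-∧

    rec-⊎ : Rec (λ K ρ v → P K ρ v ⊎ Q K ρ v)
    rec-⊎ = rec-pair _∨_ reflects-∨

  rec-∘ : ∀ {P : Pred} (σ : ℕ → ℕ) → Rec P → Rec (λ K ρ v → P K ρ (v ∘ σ))
  rec-∘ σ R = record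
    { labelling = labelling R
    ; automaton = pullback id σ (automaton R)
    ; start = start R ; accept = accept R
    ; correct = λ K ρ init v → reflects-≡ (cong (accept R) (sym
        (trans (run-pullback id σ (automaton R) v 0 (word (labelling R) K ρ) (start R))
          (cong (λ u → run (δ (automaton R)) (mark (v ∘ σ) 0 u) (start R)) (map-id (word (labelling R) K ρ))))))
        (correct R K ρ init (v ∘ σ)) }

  rec-∃ : ∀ {P : Pred} → Rec P → Rec (λ K ρ v → Σ[ p ∈ ℕ ] p < ∣ ρ ∣ × P K ρ (p ▸ v))
  rec-∃ R = record
    { labelling = labelling R
    ; automaton = guess
    ; start = startᴳ (start R) (accept R) ; accept = acceptᴳ (start R) (accept R)
    ; correct = λ K ρ init v → ⇔.trans
        (mk⇔ (λ (p , lt , h) → p , subst (p <_) (sym (length-word (labelling R) K ρ)) lt ,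
               to (correct R K ρ init (p ▸ v)) h)
             (λ (p , lt , h) → p , subst (p <_) (length-word (labelling R) K ρ) lt ,
               from (correct R K ρ init (p ▸ v)) h))
        (acceptᴳ-correct (start R) (accept R) v (word (labelling R) K ρ)) }
    where open Guess (automaton R)

  prefix : ∀ {A n} → Labelling {k} A → (K : Kripke k n) (ρ : Trace K) → Pos K ρ → List A
  prefix L K ρ i = map (lab L K) (before (st ρ) i ++ st ρ i ∷ [])

  word-split : ∀ {A n} (L : Labelling {k} A) (K : Kripke k n) (ρ : Trace K) i →
               word L K ρ ≡ map (lab L K) (before (st ρ) i) ++ lab L K (st ρ i) ∷ map (lab L K) (after (st ρ) i)
  word-split L K ρ i = trans (cong (map (lab L K)) (tabulate-split (st ρ) i))
                             (map-++ (lab L K) (before (st ρ) i) (st ρ i ∷ after (st ρ) i))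

  length-before-lab : ∀ {A n} (L : Labelling {k} A) (K : Kripke k n) (ρ : Trace K) i →
                      length (map (lab L K) (before (st ρ) i)) ≡ toℕ i
  length-before-lab L K ρ i = trans (length-map (lab L K) (before (st ρ) i)) (length-before (st ρ) i)

  AtPointer : ∀ {n} {K : Kripke k n} (ρ : Trace K) → (ℕ → ℕ) → (Pos K ρ → Set) → Set
  AtPointer {K = K} ρ v P = Σ[ i ∈ Pos K ρ ] toℕ i ≡ v 0 × P i

  at-pointer : ∀ {n} {K : Kripke k n} (ρ : Trace K) (v : ℕ → ℕ) {P : Pos K ρ → Set} i → toℕ i ≡ v 0 →
               AtPointer ρ v P → P i
  at-pointer ρ v {P} i eq (j , eq′ , p) = subst P (toℕ-injective (trans eq′ (sym eq))) p

  position : ∀ {n} {K : Kripke k n} (ρ : Trace K) p → p < ∣ ρ ∣ → Σ[ i ∈ Pos K ρ ] toℕ i ≡ p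
  position ρ p lt = fromℕ< lt , toℕ-fromℕ< lt

  pos< : ∀ {n} {K : Kripke k n} (ρ : Trace K) (i : Pos K ρ) {p} → toℕ i ≡ p → p < ∣ ρ ∣
  pos< ρ i refl = toℕ<n i

  rec-freeze : ∀ {A} (L : Labelling {k} A) (D : Automaton A) (start : State D) (out : A → State D → Bool) →
    Rec (λ K ρ v → AtPointer ρ v λ i →
      out (lab L K (st ρ i)) (run (δ D) (mark v 0 (prefix L K ρ i)) start) ≡ true)
  rec-freeze L D start out = record
    { labelling = L ; automaton = freeze ; start = inj₁ start ; accept = acceptᶠ ; correct = ok′ }
    where
    open Freeze D out
    ok′ : ∀ {n} (K : Kripke k n) ρ → Initial K ρ → ∀ v →
      acceptᶠ (run δᶠ (mark v 0 (word L K ρ)) (inj₁ start)) reflects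
      (AtPointer ρ v λ i → out (lab L K (st ρ i)) (run (δ D) (mark v 0 (prefix L K ρ i)) start) ≡ true)
    ok′ K ρ init v with v 0 <? ∣ ρ ∣
    ... | no v≮ = reflects-≡
      (cong acceptᶠ (sym (run-never v 0 (word L K ρ) start
        (subst (_≤ v 0) (sym (length-word L K ρ)) (≮⇒≥ v≮)))))
      (mk⇔ (λ (i , eq , _) → contradiction (pos< ρ i eq) v≮) (λ ()))
    ... | yes v< with position ρ (v 0) v<
    ...   | i , eq = reflects-≡ (cong acceptᶠ (sym frozen))
                       (mk⇔ (at-pointer ρ v i eq) (λ h → i , eq , h))
      where
      u = map (lab L K) (before (st ρ) i)
      a = lab L K (st ρ i)
      frozen : run δᶠ (mark v 0 (word L K ρ)) (inj₁ start) ≡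
               inj₂ (out a (run (δ D) (mark v 0 (prefix L K ρ i)) start))
      frozen = trans (cong (λ z → run δᶠ (mark v 0 z) (inj₁ start)) (word-split L K ρ i))
        (trans (run-at v 0 u a (map (lab L K) (after (st ρ) i)) start
                 (trans (sym eq) (sym (length-before-lab L K ρ i))))
               (cong (λ z → inj₂ (out a (run (δ D) (mark v 0 z) start)))
                 (sym (map-++ (lab L K) (before (st ρ) i) (st ρ i ∷ [])))))

  rec-atom : ∀ p → Rec (λ K ρ v → AtPointer ρ v λ i → Kripke.μ K (st ρ i) p ≡ true)
  rec-atom p = rec-freeze (boolLabelling {k} (atom p) (λ K s → Kripke.μ K s p) (λ _ _ _ → ⇔.refl))
                 seen false (λ a _ → a)

  rec-≤ : ∀ x y → Rec (λ K ρ v → v x ≤ v y × v y < ∣ ρ ∣)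
  -- The renaming puts `y` at pointer 0, where reading stops, and `x` at pointer 1, which `seen`
  -- watches.
  rec-≤ x y = rec-∘ {P = λ K ρ v → v 1 ≤ v 0 × v 0 < ∣ ρ ∣} (y ▸ λ _ → x)
    (rec-cong (λ K ρ _ v → mk⇔ (fwd ρ v) (bwd ρ v)) (rec-freeze trivialLabelling seen false (λ _ s → s)))
    where
    seen-before : ∀ {n} {K : Kripke k n} (ρ : Trace K) v i → toℕ i ≡ v 0 →
      run (δ seen) (mark v 0 (prefix trivialLabelling K ρ i)) false reflects (v 1 ≤ v 0)
    seen-before {K = K} ρ v i eq = ⇔.trans
      (mk⇔ (λ le → inj₂ (z≤n , subst (v 1 <_) (sym length≡) (s≤s le)))
           (λ { (inj₁ ()) ; (inj₂ (_ , lt)) → ≤-pred (subst (v 1 <_) length≡ lt) }))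
      (run-seen v 0 (prefix trivialLabelling K ρ i) false)
      where
      length≡ : length (prefix trivialLabelling K ρ i) ≡ suc (v 0)
      length≡ = trans (length-map _ (before (st ρ) i ++ st ρ i ∷ []))
        (trans (length-++ (before (st ρ) i))
          (trans (+-comm _ 1) (cong suc (trans (length-before (st ρ) i) eq))))
    fwd : ∀ {n} {K : Kripke k n} (ρ : Trace K) v →
      (AtPointer ρ v λ i → run (δ seen) (mark v 0 (prefix trivialLabelling K ρ i)) false ≡ true) →
      v 1 ≤ v 0 × v 0 < ∣ ρ ∣
    fwd ρ v (i , eq , h) = from (seen-before ρ v i eq) h , pos< ρ i eq
    bwd : ∀ {n} {K : Kripke k n} (ρ : Trace K) v → v 1 ≤ v 0 × v 0 < ∣ ρ ∣ →
      (AtPointer ρ v λ i → run (δ seen) (mark v 0 (prefix trivialLabelling K ρ i)) false ≡ true)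
    bwd ρ v (le , lt) with position ρ (v 0) lt
    ... | i , eq = i , eq , to (seen-before ρ v i eq) le

  rec-in : Rec (λ K ρ v → v 0 < ∣ ρ ∣)
  rec-in = rec-cong (λ _ _ _ _ → mk⇔ proj₂ (λ lt → ≤-refl , lt)) (rec-≤ 0 0)

  rec-< : ∀ x y → Rec (λ K ρ v → v x < v y × v y < ∣ ρ ∣)
  rec-< x y = rec-cong
    (λ K ρ _ v → mk⇔
      (λ ((le , lt) , ¬ge) → ≰⇒> (λ ge → ¬ge (ge , ≤-<-trans le lt)) , lt)
      (λ (l , lt) → (<⇒≤ l , lt) , λ (ge , _) → <⇒≱ l ge))
    (rec-× (rec-≤ x y) (rec-¬ (rec-≤ y x)))

  rec-suc : ∀ x y → Rec (λ K ρ v → v y ≡ suc (v x) × v y < ∣ ρ ∣)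
  rec-suc x y = rec-cong
    {P = λ K ρ v → (v x < v y × v y < ∣ ρ ∣) × ¬ (Σ[ l ∈ ℕ ] l < ∣ ρ ∣ ×
           (v x < l × l < ∣ ρ ∣) × (l < v y × v y < ∣ ρ ∣))}
    (λ K ρ _ v → mk⇔
      (λ ((l , lt) , ¬between) → ≤-antisym
          (≮⇒≥ (λ l′ → let lt′ = <-≤-trans l′ (<⇒≤ lt) in
            ¬between (suc (v x) , lt′ , (n<1+n (v x) , lt′) , l′ , lt))) l , lt)
      (λ (eq , lt) → (≤-reflexive (sym eq) , lt) ,
        λ (l , _ , (x<l , _) , (l<y , _)) → <⇒≱ l<y (subst (_≤ l) (sym eq) x<l)))
    (rec-× (rec-< x y) (rec-¬ (rec-∃ (rec-× (rec-< (suc x) 0) (rec-< 0 (suc y))))))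

  -- Existential path quantification

  vecLabelling : ∀ m (β : Fin m → CForm k) (b : ∀ {n} → Kripke k n → Fin n → Fin m → Bool) →
    (∀ {n} (K : Kripke k n) s w i → b K s i reflects satL K (β i) s w) →
    Σ[ L ∈ Labelling {k} (Vec Bool m) ] (∀ {n} (K : Kripke k n) s i → lookup (lab L K s) i ≡ b K s i)
  vecLabelling zero β b r = record
    { finite = finVec (2 , ↔-sym 2↔Bool) 0 ; θ = λ _ → ⊤c ; lab = λ _ _ → []
    ; ok = λ { _ _ _ [] → mk⇔ (λ _ → refl) (λ _ → tt) } } , λ _ _ ()
  vecLabelling (suc m) β b r with vecLabelling m (β ∘ suc) (λ K s → b K s ∘ suc) (λ K s w → r K s w ∘ suc)
  ... | L , eq = record
    { finite = finVec (2 , ↔-sym 2↔Bool) (suc m)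
    ; θ = λ { (a ∷ as) → θ bit₀ a ∧c θ L as }
    ; lab = λ K s → b K s zero ∷ lab L K s
    ; ok = λ { K s w (a ∷ as) → ⇔.trans (ok bit₀ K s w a ×-⇔ ok L K s w as)
                 (mk⇔ (λ (e , e′) → cong₂ _∷_ e e′) (λ { refl → refl , refl })) } } ,
    λ { K s zero → refl ; K s (suc i) → eq K s i }
    where
    bit₀ : Labelling Bool
    bit₀ = boolLabelling (β zero) (λ K s → b K s zero) (λ K s w → r K s w zero)

  module _ {A : Set} (L : Labelling {k} A) (D : Automaton A) (accept : State D → Bool) where
    open Enum (finite L) using (decEq; elements; ∈-elements)
    open Enum (finite D) using () renaming
      (size to ∣D∣; enc to encD; dec to decD; enc-dec to enc-decD; dec-enc to dec-encD; decEq to decEqD)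
    open Semantics decEq
    open Definability (const ⊤)

    def-accept : ∀ q → Def (λ w → accept (run (unmarked D) w q))
    def-accept q = def-cong
      (λ w _ → cong accept (trans (run-sim decD (λ a i → dec-encD _) w (encD q)) (cong (run (unmarked D) w) (dec-encD q))))
      (def-case (λ w → run δᵉ w (encD q))
        (counterFree⇒LTL ∣D∣ decEq (const ⊤) δᵉ (bound D) elements
          (λ b b∉ → ⊥-elim (b∉ (∈-elements b))) aperiodicᵉ (encD q))
        (λ t → def-const (accept (decD t))))
      where
      δᵉ : A → Fin ∣D∣ → Fin ∣D∣
      δᵉ a i = encD (unmarked D a (decD i))
      aperiodicᵉ : Aperiodic (const ⊤) δᵉ (bound D)
      aperiodicᵉ u _ = stable-sim decD (λ {i} {j} e → trans (sym (enc-decD i)) (trans (cong encD e) (enc-decD j)))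
        (run-sim decD (λ a i → dec-encD _) u) (bound D)
        (λ q → trans (iter-sim id (run-map (δ D) (λ a → a , const false) u) (bound D) q)
          (trans (aperiodic D (map (λ a → a , const false) u) q)
            (sym (iter-sim id (run-map (δ D) (λ a → a , const false) u) (suc (bound D)) q))))

    -- The letter of the current state has already been read into `q`, so the run starts one
    -- position later, hence the `next`. The continuation may be empty, which is why LTL is used
    -- with empty words.
    tailC : State D → CForm k
    tailC q = FromLTL.toC L (next (proj₁ (def-accept q)))

    tailC-ok : ∀ {n} (K : Kripke k n) q s w →
               accept (run (unmarked D) (map (lab L K) w) q) reflects satL K (tailC q) s w
    tailC-ok K q s w = reflects-≡ (proj₂ (def-accept q) (map (lab L K) w) (universal (λ _ → tt) _))
                         (FromLTL.toC-ok L K (next (proj₁ (def-accept q))) s w)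

    Continues : ∀ {n} (K : Kripke k n) → Fin n → State D → Set
    Continues K s q = Σ[ w ∈ List _ ] Path K s w × accept (run (unmarked D) (map (lab L K) w) q) ≡ true

    -- A path together with the run on it is a path in the finite product of `K` and the automaton.
    continues? : ∀ {n} (K : Kripke k n) s q → Dec (Continues K s q)
    continues? {n} K s q = map′
      (λ (_ , reach , e) → let w , p , eq = star⇒path reach in w , p , trans (cong accept eq) e)
      (λ (w , p , e) → _ , proj₂ (path⇒star s q w p) , e) search
      where
      Node : Set
      Node = Fin n × State D
      open Enum (fin× (finFin {n}) (finite D)) using (dec; enc; dec-enc)
        renaming (decEq to decEqNode; elements to nodes; ∈-elements to ∈-nodes)
      Edge : Node → Node → Set
      Edge (s , q) (t , r) = Kripke.δ K s t ≡ true × unmarked D (lab L K t) q ≡ r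
      open Reachability decEqNode Edge
        (λ (s , q) (t , r) → (Kripke.δ K s t ≟ᵇ true) ×-dec decEqD (unmarked D (lab L K t) q) r) nodes ∈-nodes
      path⇒star : ∀ s q w → Path K s w →
        Σ[ t ∈ Fin n ] Star Edge (s , q) (t , run (unmarked D) (map (lab L K) w) q)
      path⇒star s q []      p       = s , ε
      path⇒star s q (t ∷ w) (e , p) with path⇒star t (unmarked D (lab L K t) q) w p
      ... | r , reach = r , (e , refl) ◅ reach
      star⇒path : ∀ {s q t r} → Star Edge (s , q) (t , r) →
        Σ[ w ∈ List _ ] Path K s w × run (unmarked D) (map (lab L K) w) q ≡ r
      star⇒path ε = [] , tt , refl
      star⇒path (_◅_ {j = t , _} (e , refl) rest) with star⇒path rest
      ... | w , p , eq = t ∷ w , (e , p) , eq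
      search : Dec (Σ[ x ∈ Node ] Star Edge (s , q) x × accept (proj₂ x) ≡ true)
      search = map′ (λ (i , h) → dec i , h)
        (λ (x , h) → enc x ,
          subst (λ x → Star Edge (s , q) x × accept (proj₂ x) ≡ true) (sym (dec-enc x)) h)
        (any? (λ i → reach? (s , q) (dec i) ×-dec (accept (proj₂ (dec i)) ≟ᵇ true)))

    -- Each letter is enriched by one bit for every state `q`, the truth value of `∃fc (tailC q)`.
    -- On freezing, the bit belonging to the state just reached is read off.
    rec-continues : ∀ start → Rec (λ K ρ v → AtPointer ρ v λ i →
      Continues K (st ρ i) (run (δ D) (mark v 0 (prefix L K ρ i)) start))
    rec-continues start = rec-cong
      (λ K ρ _ v → mk⇔ (λ (i , eq , h) → i , eq , from (bit K ρ v i) h) (λ (i , eq , h) → i , eq , to (bit K ρ v i) h))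
      (rec-freeze (L ×-label proj₁ bits) (pullback proj₁ id D) start (λ (_ , b) q → lookup b (encD q)))
      where
      β : Fin ∣D∣ → CForm k
      β i = ∃fc (tailC (decD i))
      β-ok : ∀ {n} (K : Kripke k n) s w i → does (continues? K s (decD i)) reflects satL K (β i) s w
      β-ok K s w i = ⇔.trans
        (mk⇔ (λ (v , p , h) → v , p , to (tailC-ok K (decD i) s v) h)
             (λ (v , p , h) → v , p , from (tailC-ok K (decD i) s v) h))
        (does-reflects (continues? K s (decD i)))
      bits : Σ[ M ∈ Labelling {k} (Vec Bool ∣D∣) ]
               (∀ {n} (K : Kripke k n) s i → lookup (lab M K s) i ≡ does (continues? K s (decD i)))
      bits = vecLabelling ∣D∣ β (λ K s i → does (continues? K s (decD i))) β-ok
      bit : ∀ {n} (K : Kripke k n) ρ v i →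
        lookup (lab (proj₁ bits) K (st ρ i))
          (encD (run (δ (pullback proj₁ id D)) (mark v 0 (prefix (L ×-label proj₁ bits) K ρ i)) start))
        reflects Continues K (st ρ i) (run (δ D) (mark v 0 (prefix L K ρ i)) start)
      bit K ρ v i = reflects-≡ (sym (trans (cong (λ q → lookup (lab (proj₁ bits) K (st ρ i)) (encD q)) run≡)
                                          (proj₂ bits K (st ρ i) (encD q))))
          (⇔.trans (mk⇔ (subst (Continues K (st ρ i)) (sym (dec-encD q))) (subst (Continues K (st ρ i)) (dec-encD q)))
            (does-reflects (continues? K (st ρ i) (decD (encD q)))))
        where
        M = L ×-label proj₁ bits
        q : State D
        q = run (δ D) (mark v 0 (prefix L K ρ i)) start
        run≡ : run (δ (pullback proj₁ id D)) (mark v 0 (prefix M K ρ i)) start ≡ q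
        run≡ = trans (run-pullback proj₁ id D v 0 (prefix M K ρ i) start)
          (cong (λ u → run (δ D) (mark v 0 u) start)
            (sym (map-∘ {g = proj₁} {f = lab M K} (before (st ρ) i ++ st ρ i ∷ []))))

  Branch : Pred → Pred
  Branch P K ρ v = AtPointer ρ v λ i → Σ[ ρ′ ∈ Trace K ] Initial K ρ′ × AgreeUpTo K ρ ρ′ (toℕ i)
    × (Σ[ i′ ∈ Pos K ρ′ ] (toℕ i′ ≡ toℕ i) × P K ρ′ v)

  -- When all pointers lie in the prefix, P at an extension only depends on the state
  -- of the automaton after the prefix and on the unmarked continuation.
  module Branching {P : Pred} (R : Rec P) where
    open Rec R using () renaming (labelling to L; automaton to D; start to q₀; accept to acc; correct to R-ok)

    Shared : Pred
    Shared K ρ v = AtPointer ρ v λ i →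
      Continues L D acc K (st ρ i) (run (δ D) (mark v 0 (prefix L K ρ i)) q₀)

    run-prefix : ∀ {n} (K : Kripke k n) (ρ : Trace K) v → (∀ y → v y ≤ v 0) → ∀ i → toℕ i ≡ v 0 →
      run (δ D) (mark v 0 (word L K ρ)) q₀ ≡
      run (unmarked D) (map (lab L K) (after (st ρ) i)) (run (δ D) (mark v 0 (prefix L K ρ i)) q₀)
    run-prefix K ρ v le i eq = begin
      run (δ D) (mark v 0 (word L K ρ)) q₀
        ≡⟨ cong (λ u → run (δ D) (mark v 0 u) q₀) word≡ ⟩
      run (δ D) (mark v 0 (prefix L K ρ i ++ map (lab L K) (after (st ρ) i))) q₀
        ≡⟨ cong (λ u → run (δ D) u q₀) (mark-++ v 0 (prefix L K ρ i) _) ⟩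
      run (δ D) (mark v 0 (prefix L K ρ i) ++ mark v (length (prefix L K ρ i)) (map (lab L K) (after (st ρ) i))) q₀
        ≡⟨ run-++ (δ D) (mark v 0 (prefix L K ρ i)) _ q₀ ⟩
      run (δ D) (mark v (length (prefix L K ρ i)) (map (lab L K) (after (st ρ) i))) (run (δ D) (mark v 0 (prefix L K ρ i)) q₀)
        ≡⟨ run-unmarked D (λ y → subst (v y <_) (sym length≡) (s≤s (le y))) (map (lab L K) (after (st ρ) i)) _ ⟩
      run (unmarked D) (map (lab L K) (after (st ρ) i)) (run (δ D) (mark v 0 (prefix L K ρ i)) q₀) ∎
      where
      open ≡-Reasoning
      word≡ : word L K ρ ≡ prefix L K ρ i ++ map (lab L K) (after (st ρ) i)
      word≡ = trans (cong (map (lab L K)) (trans (tabulate-split (st ρ) i)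
                (sym (++-assoc (before (st ρ) i) (st ρ i ∷ []) (after (st ρ) i)))))
              (map-++ (lab L K) (before (st ρ) i ++ st ρ i ∷ []) (after (st ρ) i))
      length≡ : length (prefix L K ρ i) ≡ suc (v 0)
      length≡ = trans (length-map _ (before (st ρ) i ++ st ρ i ∷ []))
        (trans (length-++ (before (st ρ) i))
          (trans (+-comm _ 1) (cong suc (trans (length-before (st ρ) i) eq))))

    prefix-agree : ∀ {n} (K : Kripke k n) (ρ ρ′ : Trace K) i i′ → toℕ i′ ≡ toℕ i → AgreeUpTo K ρ ρ′ (toℕ i) →
      prefix L K ρ i ≡ prefix L K ρ′ i′
    prefix-agree K ρ ρ′ i i′ eq ag = cong₂ (λ u s → map (lab L K) (u ++ s ∷ []))
      (agree⇒before (st ρ) (st ρ′) i i′ (sym eq) ag) (ag i i′ (sym eq) ≤-refl)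

    fwd : ∀ {n} (K : Kripke k n) ρ → Initial K ρ → ∀ v → (∀ y → v y ≤ v 0) →
      Shared K ρ v → Branch P K ρ v
    fwd K ρ init v le (i , eq , w , p , h) =
      i , eq , E.trace , trans E.start init , E.agree , E.pos , E.toℕ-pos ,
      from (R-ok K E.trace (trans E.start init) v)
        (trans (cong acc (trans (run-prefix K E.trace v le E.pos (trans E.toℕ-pos eq))
          (cong₂ (λ u u′ → run (unmarked D) (map (lab L K) u) (run (δ D) (mark v 0 u′) q₀))
            E.≡after (sym (prefix-agree K ρ E.trace i E.pos E.toℕ-pos E.agree))))) h)
      where module E = Extension (extend K ρ i w p)

    bwd : ∀ {n} (K : Kripke k n) ρ → Initial K ρ → ∀ v → (∀ y → v y ≤ v 0) → Branch P K ρ v → Shared K ρ v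
    bwd K ρ init v le (i , eq , ρ′ , init′ , ag , i′ , eq′ , h) =
      i , eq , after (st ρ′) i′ ,
      subst (λ s → Path K s (after (st ρ′) i′)) (sym (ag i i′ (sym eq′) ≤-refl)) (path-after K ρ′ i′) ,
      trans (cong acc (trans
        (cong (λ u → run (unmarked D) (map (lab L K) (after (st ρ′) i′)) (run (δ D) (mark v 0 u) q₀))
          (prefix-agree K ρ ρ′ i i′ eq′ ag))
        (sym (run-prefix K ρ′ v le i′ (trans eq′ eq)))))
      (to (R-ok K ρ′ init′ v) h)

    abstract
      Branch′ : Pred
      Branch′ = Shared

      rec-Branch′ : Rec Branch′
      rec-Branch′ = rec-continues L D acc q₀

      Branch′⇔Branch : ∀ {n} (K : Kripke k n) ρ → Initial K ρ → ∀ v → (∀ y → v y ≤ v 0) →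
                       Branch′ K ρ v ⇔ Branch P K ρ v
      Branch′⇔Branch K ρ init v le = mk⇔ (fwd K ρ init v le) (bwd K ρ init v le)

-- Hybrid formulas as recognisable predicates

open Trace using (st; len)

Σ-⇔ : {A : Set} {P Q : A → Set} → (∀ x → P x ⇔ Q x) → Σ A P ⇔ Σ A Q
Σ-⇔ eq = mk⇔ (λ (x , p) → x , to (eq x) p) (λ (x , q) → x , from (eq x) q)

Π-⇔ : {A : Set} {P Q : A → Set} → (∀ x → P x ⇔ Q x) → (∀ x → P x) ⇔ (∀ x → Q x)
Π-⇔ eq = mk⇔ (λ f x → to (eq x) (f x)) (λ f x → from (eq x) (f x))

→-⇔ : {A P Q : Set} → P ⇔ Q → (A → P) ⇔ (A → Q)
→-⇔ eq = Π-⇔ (λ _ → eq)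

¬¬-∧ : {A B : Set} → Dec A → Dec B → (¬ (¬ A ⊎ ¬ B)) ⇔ (A × B)
¬¬-∧ a? b? = mk⇔ (λ h → decidable-stable a? (h ∘ inj₁) , decidable-stable b? (h ∘ inj₂))
                 (λ (a , b) → λ { (inj₁ ¬a) → ¬a a ; (inj₂ ¬b) → ¬b b })

module _ {k : ℕ} where

  satH-ext : (φ : HForm k) {g g′ : Valuation} → (∀ x → Free x φ → g x ≡ g′ x) →
             ∀ {n} (K : Kripke k n) ρ i → satH K ρ g i φ ⇔ satH K ρ g′ i φ
  satH-ext ⊤h        eq K ρ i = ⇔.refl
  satH-ext (atom p)  eq K ρ i = ⇔.refl
  satH-ext (var x)   eq K ρ i = mk⇔ (trans (sym (eq x fvar))) (trans (eq x fvar))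
  satH-ext (¬h φ)    eq K ρ i = ¬-cong (satH-ext φ (λ x → eq x ∘ f¬) K ρ i)
  satH-ext (φ ∨h ψ)  eq K ρ i =
    satH-ext φ (λ x → eq x ∘ f∨ˡ) K ρ i ⊎-⇔ satH-ext ψ (λ x → eq x ∘ f∨ʳ) K ρ i
  satH-ext (↓ x · φ) {g} {g′} eq K ρ i = satH-ext φ rebound K ρ i
    where
    rebound : ∀ y → Free y φ → (g [ x ← toℕ i ]) y ≡ (g′ [ x ← toℕ i ]) y
    rebound y fr with y ≟ℕ x
    ... | yes _  = refl
    ... | no y≢x = eq y (f↓ y≢x fr)
  satH-ext (Xh φ)    eq K ρ i = Σ-⇔ λ j → ⇔.refl ×-⇔ satH-ext φ (λ x → eq x ∘ fX) K ρ j
  satH-ext (φ Uh ψ)  eq K ρ i = Σ-⇔ λ j → ⇔.refl ×-⇔ (satH-ext ψ (λ x → eq x ∘ fUʳ) K ρ j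
    ×-⇔ Π-⇔ λ l → →-⇔ (→-⇔ (satH-ext φ (λ x → eq x ∘ fUˡ) K ρ l)))
  satH-ext (X⁻ φ)    eq K ρ i = Σ-⇔ λ j → ⇔.refl ×-⇔ satH-ext φ (λ x → eq x ∘ fX⁻) K ρ j
  satH-ext (φ U⁻ ψ)  eq K ρ i = Σ-⇔ λ j → ⇔.refl ×-⇔ (satH-ext ψ (λ x → eq x ∘ fU⁻ʳ) K ρ j
    ×-⇔ Π-⇔ λ l → →-⇔ (→-⇔ (satH-ext φ (λ x → eq x ∘ fU⁻ˡ) K ρ l)))
  satH-ext (∃fh φ)   eq K ρ i = Σ-⇔ λ ρ′ → ⇔.refl ×-⇔ (⇔.refl ×-⇔
    Σ-⇔ λ i′ → ⇔.refl ×-⇔ satH-ext φ (λ x → eq x ∘ f∃) K ρ′ i′)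

  -- Pointer 0 is the current position, pointer suc x the value of the variable x.
  ⟦_⟧ : HForm k → Pred {k}
  ⟦ φ ⟧ K ρ v = AtPointer ρ v λ i → satH K ρ (v ∘ suc) i φ

  -- Renamings replacing pointer 0 when one or two further pointers have been pushed.
  push₁ push₂ : ℕ → ℕ
  push₁ = 0 ▸ λ x → suc (suc x)
  push₂ = 0 ▸ λ x → suc (suc (suc x))

  -- The four modalities share one first-order shape: `S` relates the current position to the
  -- witness for `ψ`, and `B` singles out the positions where `φ` is required. `C` and `D` express
  -- them in terms of pointers, the newest one being 0.
  module Modal {S : ℕ → ℕ → Set} {B : ℕ → ℕ → ℕ → Set} {C D : Pred {k}}
    (R : Rec (λ {n} → C {n})) (Q : Rec (λ {n} → D {n}))
    (C⇔S : ∀ {n} (K : Kripke k n) ρ v → v 0 < ∣ ρ ∣ → v 1 < ∣ ρ ∣ → C K ρ v ⇔ S (v 1) (v 0))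
    (D⇔B : ∀ {n} (K : Kripke k n) ρ v → v 0 < ∣ ρ ∣ → v 1 < ∣ ρ ∣ → v 2 < ∣ ρ ∣ →
             D K ρ v ⇔ B (v 2) (v 1) (v 0))
    {φ ψ : HForm k} (Φ : Rec ⟦ φ ⟧) (Ψ : Rec ⟦ ψ ⟧) where

    Goal : Pred {k}
    Goal K ρ v = AtPointer ρ v λ i → Σ[ j ∈ Pos K ρ ] S (toℕ i) (toℕ j) × satH K ρ (v ∘ suc) j ψ
      × (∀ l → B (toℕ i) (toℕ j) (toℕ l) → satH K ρ (v ∘ suc) l φ)

    FO : Pred {k}
    FO K ρ v = v 0 < ∣ ρ ∣ × (Σ[ p ∈ ℕ ] p < ∣ ρ ∣ × C K ρ (p ▸ v) × ⟦ ψ ⟧ K ρ ((p ▸ v) ∘ push₁)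
      × ¬ (Σ[ q ∈ ℕ ] q < ∣ ρ ∣ × D K ρ (q ▸ p ▸ v) × ¬ ⟦ φ ⟧ K ρ ((q ▸ p ▸ v) ∘ push₂)))

    FO⇔Goal : ∀ {n} (K : Kripke k n) ρ → Initial K ρ → ∀ v → FO K ρ v ⇔ Goal K ρ v
    FO⇔Goal K ρ init v = mk⇔ fwd bwd
      where
      fwd : FO K ρ v → Goal K ρ v
      fwd (v< , p , p< , c , (j , refl , h) , ¬viol) with position ρ (v 0) v<
      ... | i , eq = i , eq , j , subst (λ z → S z (toℕ j)) (sym eq) (to (C⇔S K ρ (toℕ j ▸ v) p< v<) c) , h ,
        λ l b → at-pointer ρ (toℕ l ▸ v ∘ suc) l refl
          -- The universal quantifier is recognised as ¬∃¬; `φ` is recovered from it because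
          -- recognisable predicates are decidable.
          (decidable-stable (rec? Φ K ρ init (toℕ l ▸ v ∘ suc)) λ unsat → ¬viol (toℕ l , toℕ<n l ,
            from (D⇔B K ρ (toℕ l ▸ toℕ j ▸ v) (toℕ<n l) p< v<) (subst (λ z → B z (toℕ j) (toℕ l)) eq b) ,
            unsat))
      bwd : Goal K ρ v → FO K ρ v
      bwd (i , eq , j , s , h , all) = v< , toℕ j , toℕ<n j ,
        from (C⇔S K ρ (toℕ j ▸ v) (toℕ<n j) v<) (subst (λ z → S z (toℕ j)) eq s) , (j , refl , h) ,
        λ { (q , q< , d , unsat) → let l , eq′ = position ρ q q< in unsat (l , eq′ , all l
              (subst₂ (λ z z′ → B z (toℕ j) z′) (sym eq) (sym eq′)
                (to (D⇔B K ρ (q ▸ toℕ j ▸ v) q< (toℕ<n j) v<) d))) }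
        where
        v< : v 0 < ∣ ρ ∣
        v< = pos< ρ i eq

    rec-modal : Rec Goal
    rec-modal = rec-cong {P = FO} FO⇔Goal
      (rec-× rec-in (rec-∃ (rec-× R (rec-× (rec-∘ {P = ⟦ ψ ⟧} push₁ Ψ)
        (rec-¬ (rec-∃ (rec-× Q (rec-¬ (rec-∘ {P = ⟦ φ ⟧} push₂ Φ)))))))))

  open Modal using (rec-modal)

  at-⇔ : ∀ {n} {K : Kripke k n} (ρ : Trace K) v {P Q : Pos K ρ → Set} → (∀ i → P i ⇔ Q i) →
         AtPointer ρ v P ⇔ AtPointer ρ v Q
  at-⇔ ρ v eq = Σ-⇔ λ i → ⇔.refl ×-⇔ eq i

  -- The until shape with no constrained positions: the irreflexive `rec-< 0 0` recognises the empty
  -- relation.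
  rec-X : ∀ {φ} → Rec ⟦ φ ⟧ → Rec ⟦ Xh φ ⟧
  rec-X {φ} Φ = rec-cong
    (λ K ρ _ v → at-⇔ ρ v λ i → Σ-⇔ λ j → ⇔.refl ×-⇔ mk⇔ proj₁ (λ h → h , λ _ ()))
    (rec-modal {S = λ i j → j ≡ suc i} {B = λ _ _ _ → ⊥} (rec-suc 1 0) (rec-< 0 0)
      (λ K ρ v v₀< _ → mk⇔ proj₁ (_, v₀<))
      (λ K ρ v _ _ _ → mk⇔ (<-irrefl refl ∘ proj₁) ⊥-elim) {φ} {φ} Φ Φ)

  rec-X⁻ : ∀ {φ} → Rec ⟦ φ ⟧ → Rec ⟦ X⁻ φ ⟧
  rec-X⁻ {φ} Φ = rec-cong
    (λ K ρ _ v → at-⇔ ρ v λ i → Σ-⇔ λ j → mk⇔ sym sym ×-⇔ mk⇔ proj₁ (λ h → h , λ _ ()))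
    (rec-modal {S = λ i j → i ≡ suc j} {B = λ _ _ _ → ⊥} (rec-suc 0 1) (rec-< 0 0)
      (λ K ρ v _ v₁< → mk⇔ proj₁ (_, v₁<))
      (λ K ρ v _ _ _ → mk⇔ (<-irrefl refl ∘ proj₁) ⊥-elim) {φ} {φ} Φ Φ)

  rec-U : ∀ {φ ψ} → Rec ⟦ φ ⟧ → Rec ⟦ ψ ⟧ → Rec ⟦ φ Uh ψ ⟧
  rec-U {φ} {ψ} Φ Ψ = rec-cong
    (λ K ρ _ v → at-⇔ ρ v λ i → Σ-⇔ λ j → ⇔.refl ×-⇔ (⇔.refl ×-⇔ Π-⇔ λ l →
      mk⇔ (λ h le lt → h (le , lt)) (λ h (le , lt) → h le lt)))
    (rec-modal {S = λ i j → i ≤ j} {B = λ i j l → i ≤ l × l < j} (rec-≤ 1 0) (rec-× (rec-≤ 2 0) (rec-< 0 1))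
      (λ K ρ v v₀< _ → mk⇔ proj₁ (_, v₀<))
      (λ K ρ v v₀< v₁< _ → mk⇔ proj₁ (_, v₀<) ×-⇔ mk⇔ proj₁ (_, v₁<)) {φ} {ψ} Φ Ψ)

  rec-U⁻ : ∀ {φ ψ} → Rec ⟦ φ ⟧ → Rec ⟦ ψ ⟧ → Rec ⟦ φ U⁻ ψ ⟧
  rec-U⁻ {φ} {ψ} Φ Ψ = rec-cong
    (λ K ρ _ v → at-⇔ ρ v λ i → Σ-⇔ λ j → ⇔.refl ×-⇔ (⇔.refl ×-⇔ Π-⇔ λ l →
      mk⇔ (λ h lt le → h (lt , le)) (λ h (lt , le) → h lt le)))
    (rec-modal {S = λ i j → j ≤ i} {B = λ i j l → j < l × l ≤ i} (rec-≤ 0 1) (rec-× (rec-< 1 0) (rec-≤ 0 2))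
      (λ K ρ v _ v₁< → mk⇔ proj₁ (_, v₁<))
      (λ K ρ v v₀< v₁< v₂< → mk⇔ proj₁ (_, v₀<) ×-⇔ mk⇔ proj₁ (_, v₂<)) {φ} {ψ} Φ Ψ)

  -- The binder acts as a renaming: wherever `x` would be read, pointer 0 is read instead.
  rebind : Var → ℕ → ℕ
  rebind x zero    = 0
  rebind x (suc y) with y ≟ℕ x
  ... | yes _ = 0
  ... | no  _ = suc y

  rec-↓ : ∀ x {φ} → Rec ⟦ φ ⟧ → Rec ⟦ ↓ x · φ ⟧
  rec-↓ x {φ} Φ = rec-cong
    (λ K ρ _ v → Σ-⇔ λ i → Σ-⇔ λ eq → satH-ext φ (λ y _ → rebind-update v eq y) K ρ i)
    (rec-∘ {P = ⟦ φ ⟧} (rebind x) Φ)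
    where
    rebind-update : ∀ (v : ℕ → ℕ) {m} → m ≡ v 0 → ∀ y → v (rebind x (suc y)) ≡ ((v ∘ suc) [ x ← m ]) y
    rebind-update v eq y with y ≟ℕ x
    ... | yes _ = sym eq
    ... | no  _ = refl

  -- ψ may only look at pointers that lie in the prefix shared by all branches,
  -- so its other pointers are redirected to the current position.
  module PathQuantifier {ψ : HForm k} (Ψ : Rec ⟦ ψ ⟧) (p : Var → Bool)
                        (free : ∀ y → Free y ψ → p y ≡ true) where
    open Branching {P = ⟦ ψ ⟧} Ψ using (Branch′; rec-Branch′; Branch′⇔Branch)

    σ : ℕ → ℕ
    σ = 0 ▸ λ y → if p y then suc y else 0

    σ-≤ : ∀ (v : ℕ → ℕ) → (∀ y → p y ≡ true → v (suc y) ≤ v 0) → ∀ y → v (σ y) ≤ v 0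
    σ-≤ v le zero = ≤-refl
    σ-≤ v le (suc y) with p y in eq
    ... | true  = le y eq
    ... | false = ≤-refl

    σ-free : ∀ (v : ℕ → ℕ) y → Free y ψ → v (σ (suc y)) ≡ v (suc y)
    σ-free v y fr rewrite free y fr = refl

    Quantified : Pred {k}
    Quantified K ρ v = Branch′ K ρ (v ∘ σ)

    rec-Quantified : Rec Quantified
    rec-Quantified = rec-∘ {P = Branch′} σ rec-Branch′

    Quantified⇔ : ∀ {n} (K : Kripke k n) ρ → Initial K ρ → ∀ v → (∀ y → p y ≡ true → v (suc y) ≤ v 0) →
                  Quantified K ρ v ⇔ ⟦ ∃fh ψ ⟧ K ρ v
    Quantified⇔ K ρ init v le = ⇔.trans (Branch′⇔Branch K ρ init (v ∘ σ) (σ-≤ v le))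
      (Σ-⇔ λ i → Σ-⇔ λ eq → Σ-⇔ λ ρ′ → ⇔.refl ×-⇔ (⇔.refl ×-⇔ mk⇔
        (λ (i′ , eq′ , h) → i′ , eq′ ,
          to (satH-ext ψ (σ-free v) K ρ′ i′) (at-pointer ρ′ (v ∘ σ) i′ (trans eq′ eq) h))
        (λ (i′ , eq′ , h) → i′ , eq′ , i′ , trans eq′ eq , from (satH-ext ψ (σ-free v) K ρ′ i′) h)))

  rec-H : ∀ {φ} → WF φ → Rec ⟦ φ ⟧
  rec-H wf⊤ = rec-cong
    (λ K ρ _ v → mk⇔ (λ lt → let i , eq = position ρ (v 0) lt in i , eq , tt) (λ (i , eq , _) → pos< ρ i eq)) rec-in
  rec-H (wfatom {p}) = rec-atom p
  rec-H (wfvar {x}) = rec-cong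
    {P = λ K ρ v → (v (suc x) ≤ v 0 × v 0 < ∣ ρ ∣) × (v 0 ≤ v (suc x) × v (suc x) < ∣ ρ ∣)}
    (λ K ρ _ v → mk⇔
      (λ ((le , lt) , (ge , _)) → let i , eq = position ρ (v 0) lt in
        i , eq , trans (≤-antisym le ge) (sym eq))
      (λ (i , eq , eq′) → let e = trans eq′ eq in
        (≤-reflexive e , pos< ρ i eq) , (≤-reflexive (sym e) , subst (_< ∣ ρ ∣) (sym e) (pos< ρ i eq))))
    (rec-× (rec-≤ (suc x) 0) (rec-≤ 0 (suc x)))
  -- `⟦ φ ⟧` also fails when pointer 0 is off the trace, so its complement has to be confined to
  -- positions of the trace.
  rec-H (wf¬ {φ} w) = rec-cong
    {P = λ K ρ v → v 0 < ∣ ρ ∣ × ¬ ⟦ φ ⟧ K ρ v}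
    (λ K ρ _ v → mk⇔
      (λ (lt , unsat) → let i , eq = position ρ (v 0) lt in i , eq , λ h → unsat (i , eq , h))
      (λ (i , eq , unsat) → pos< ρ i eq , λ h → unsat (at-pointer ρ v i eq h)))
    (rec-× rec-in (rec-¬ {P = ⟦ φ ⟧} (rec-H w)))
  rec-H (wf∨ {φ} {ψ} w w′) = rec-cong
    {P = λ K ρ v → ⟦ φ ⟧ K ρ v ⊎ ⟦ ψ ⟧ K ρ v}
    (λ K ρ _ v → mk⇔
      (λ { (inj₁ (i , eq , h)) → i , eq , inj₁ h ; (inj₂ (i , eq , h)) → i , eq , inj₂ h })
      (λ { (i , eq , inj₁ h) → inj₁ (i , eq , h) ; (i , eq , inj₂ h) → inj₂ (i , eq , h) }))
    (rec-⊎ {P = ⟦ φ ⟧} {Q = ⟦ ψ ⟧} (rec-H w) (rec-H w′))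
  rec-H (wf↓ {x} {φ} w) = rec-↓ x {φ} (rec-H w)
  rec-H (wfX {φ} w) = rec-X {φ} (rec-H w)
  rec-H (wfU {φ} {ψ} w w′) = rec-U {φ} {ψ} (rec-H w) (rec-H w′)
  rec-H (wfX⁻ {φ} w) = rec-X⁻ {φ} (rec-H w)
  rec-H (wfU⁻ {φ} {ψ} w w′) = rec-U⁻ {φ} {ψ} (rec-H w) (rec-H w′)
  rec-H (wf∃ {ψ} closed w) = rec-cong {P = λ K ρ v → v 0 < ∣ ρ ∣ × Quantified K ρ v}
    (λ K ρ init v → mk⇔ (λ (_ , h) → to (Quantified⇔ K ρ init v (λ _ ())) h)
      (λ h → pos< ρ (proj₁ h) (proj₁ (proj₂ h)) , from (Quantified⇔ K ρ init v (λ _ ())) h))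
    (rec-× {Q = Quantified} rec-in rec-Quantified)
    where open PathQuantifier {ψ} (rec-H w) (const false) (λ y fr → ⊥-elim (closed y fr))
  -- `F⁻ x` says that the pointer of `x` is at most pointer 0, which is what `Quantified⇔` assumes.
  -- The guarded formula is thus recognised as a whole, without a recogniser for `∃fh ψ` by itself.
  rec-H (wfguard {x} {ψ} one w) = rec-cong
    {P = λ K ρ v → (v (suc x) ≤ v 0 × v 0 < ∣ ρ ∣) × Quantified K ρ v}
    (λ K ρ init v → mk⇔ (fwd K ρ init v) (bwd K ρ init v))
    (rec-× {Q = Quantified} (rec-≤ (suc x) 0) rec-Quantified)
    where
    open PathQuantifier {ψ} (rec-H w) (λ y → does (y ≟ℕ x)) (λ y fr → to (does-reflects (y ≟ℕ x)) (one y fr))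

    only : ∀ (v : ℕ → ℕ) → v (suc x) ≤ v 0 → ∀ y → does (y ≟ℕ x) ≡ true → v (suc y) ≤ v 0
    only v le y e rewrite from (does-reflects (y ≟ℕ x)) e = le

    past : ∀ {n} {K : Kripke k n} {ρ : Trace K} (v : ℕ → ℕ) (i : Pos K ρ) → toℕ i ≡ v 0 →
           v (suc x) ≤ v 0 → satH K ρ (v ∘ suc) i (F⁻ (var x))
    past {ρ = ρ} v i eq le with position ρ (v (suc x)) (≤-<-trans le (pos< ρ i eq))
    ... | j , eqj = j , subst₂ _≤_ (sym eqj) (sym eq) le , sym eqj , λ _ _ _ → tt

    fwd : ∀ {n} (K : Kripke k n) ρ → Initial K ρ → ∀ v →
          (v (suc x) ≤ v 0 × v 0 < ∣ ρ ∣) × Quantified K ρ v → ⟦ F⁻ (var x) ∧h ∃fh ψ ⟧ K ρ v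
    fwd K ρ init v ((le , lt) , h) with to (Quantified⇔ K ρ init v (only v le)) h
    ... | i , eq , h′ = i , eq , λ { (inj₁ no-past) → no-past (past {K = K} {ρ} v i eq le)
                                   ; (inj₂ no-branch) → no-branch h′ }

    bwd : ∀ {n} (K : Kripke k n) ρ → Initial K ρ → ∀ v →
          ⟦ F⁻ (var x) ∧h ∃fh ψ ⟧ K ρ v → (v (suc x) ≤ v 0 × v 0 < ∣ ρ ∣) × Quantified K ρ v
    bwd K ρ init v (i , eq , h) = (le , pos< ρ i eq) ,
      -- Conjunction being ¬(¬ ∨ ¬), the branch is only given doubly negated; the recogniser of
      -- `Quantified` decides it.
      decidable-stable (rec? {P = Quantified} rec-Quantified K ρ init v)
        (λ none → h (inj₂ (λ e → none (from (Quantified⇔ K ρ init v (only v le)) (i , eq , e)))))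
      where
      le : v (suc x) ≤ v 0
      le = decidable-stable (v (suc x) ≤? v 0)
             (λ later → h (inj₁ (λ (j , j≤i , eqj , _) → later (subst₂ _≤_ (sym eqj) eq j≤i))))

  -- From the hybrid logic to CTL*

  ⋀ : {A : Set} → (A → CForm k) → List A → CForm k
  ⋀ f []       = ⊤c
  ⋀ f (a ∷ as) = f a ∧c ⋀ f as

  ⋀-ok : ∀ {A : Set} (f : A → CForm k) as {n} (K : Kripke k n) s w →
         satL K (⋀ f as) s w ⇔ (∀ a → a ∈ as → satL K (f a) s w)
  ⋀-ok f []       K s w = mk⇔ (λ _ _ ()) (λ _ → tt)
  ⋀-ok f (a ∷ as) K s w = mk⇔
    (λ (h , hs) → λ { _ (here refl) → h ; b (there b∈) → to (⋀-ok f as K s w) hs b b∈ })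
    (λ h → h a (here refl) , from (⋀-ok f as K s w) (λ b b∈ → h b (there b∈)))

  module FromHybrid {φ : HForm k} (R : Rec ⟦ φ ⟧) where
    open Rec R
    open Labelling labelling using (θ; lab; ok)
    open Enum (Labelling.finite labelling) using (elements; ∈-elements)

    -- At the start the current position and all variables are 0, so every pointer marks the first
    -- letter and none a later one.
    first : Letter → State automaton
    first a = δ automaton (a , const true) start

    rest-holds : Letter → CForm k
    rest-holds a = tailC labelling automaton accept (first a)

    fromHybrid : CForm k
    -- A formula learns the letter of the first state only through `θ`, hence one implication for
    -- each letter.
    fromHybrid = ⋀ (λ a → ¬c (θ a ∧c ¬c (rest-holds a))) elements

    fromHybrid-ok : ∀ {n} (K : Kripke k n) ρ → Initial K ρ →
                    satH K ρ (const 0) zero φ ⇔ satC K ρ zero fromHybrid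
    fromHybrid-ok K ρ init = ⇔.trans
      (mk⇔ (λ h → zero , refl , h) (at-pointer ρ (const 0) zero refl))
      (⇔.trans (correct K ρ init (const 0))
      (⇔.trans (mk⇔ (trans (sym (cong accept run≡))) (trans (cong accept run≡)))
      (⇔.trans (⇔.sym (tailC-ok labelling automaton accept K (first (lab K s)) s w))
      (⇔.trans choose
      (⇔.trans (⇔.sym (⋀-ok (λ a → ¬c (θ a ∧c ¬c (rest-holds a))) elements K s w))
      (⇔.sym (satC⇔satL K fromHybrid ρ zero)))))))
      where
      s = st ρ zero
      w = after (st ρ) zero
      run≡ : run (δ automaton) (mark (const 0) 0 (word labelling K ρ)) start ≡
             run (unmarked automaton) (map (lab K) w) (first (lab K s))
      run≡ = run-unmarked automaton (λ _ → s≤s z≤n) (map (lab K) w) (first (lab K s))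
      choose : satL K (rest-holds (lab K s)) s w ⇔
               (∀ a → a ∈ elements → ¬ (satL K (θ a) s w × ¬ satL K (rest-holds a) s w))
      choose = mk⇔
        (λ h a _ (e , unsat) → unsat (subst (λ a → satL K (rest-holds a) s w) (to (ok K s w a) e) h))
        (λ h → decidable-stable (reflects-dec (tailC-ok labelling automaton accept K (first (lab K s)) s w))
                 (λ unsat → h (lab K s) (∈-elements (lab K s)) (from (ok K s w (lab K s)) refl , unsat)))

  -- From CTL* to the hybrid logic

  toHybrid : CForm k → HForm k
  toHybrid ⊤c       = ⊤h
  toHybrid (atom p) = atom p
  toHybrid (¬c φ)   = ¬h (toHybrid φ)
  toHybrid (φ ∧c ψ) = toHybrid φ ∧h toHybrid ψ
  toHybrid (Xc φ)   = Xh (toHybrid φ)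
  toHybrid (φ Uc ψ) = toHybrid φ Uh toHybrid ψ
  toHybrid (∃fc φ)  = ∃fh (toHybrid φ)

  toHybrid-sentence : ∀ φ → Sentence (toHybrid φ)
  toHybrid-sentence (¬c φ)   x (f¬ fr)            = toHybrid-sentence φ x fr
  toHybrid-sentence (φ ∧c ψ) x (f¬ (f∨ˡ (f¬ fr))) = toHybrid-sentence φ x fr
  toHybrid-sentence (φ ∧c ψ) x (f¬ (f∨ʳ (f¬ fr))) = toHybrid-sentence ψ x fr
  toHybrid-sentence (Xc φ)   x (fX fr)            = toHybrid-sentence φ x fr
  toHybrid-sentence (φ Uc ψ) x (fUˡ fr)           = toHybrid-sentence φ x fr
  toHybrid-sentence (φ Uc ψ) x (fUʳ fr)           = toHybrid-sentence ψ x fr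
  toHybrid-sentence (∃fc φ)  x (f∃ fr)            = toHybrid-sentence φ x fr

  toHybrid-wf : ∀ φ → WF (toHybrid φ)
  toHybrid-wf ⊤c       = wf⊤
  toHybrid-wf (atom p) = wfatom
  toHybrid-wf (¬c φ)   = wf¬ (toHybrid-wf φ)
  toHybrid-wf (φ ∧c ψ) = wf¬ (wf∨ (wf¬ (toHybrid-wf φ)) (wf¬ (toHybrid-wf ψ)))
  toHybrid-wf (Xc φ)   = wfX (toHybrid-wf φ)
  toHybrid-wf (φ Uc ψ) = wfU (toHybrid-wf φ) (toHybrid-wf ψ)
  toHybrid-wf (∃fc φ)  = wf∃ (toHybrid-sentence φ) (toHybrid-wf φ)

  satH? : ∀ {φ} → WF φ → ∀ {n} (K : Kripke k n) ρ → Initial K ρ → ∀ g i → Dec (satH K ρ g i φ)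
  satH? {φ} w K ρ init g i = map′ (at-pointer ρ (toℕ i ▸ g) i refl) (λ h → i , refl , h)
                           (rec? {P = ⟦ φ ⟧} (rec-H w) K ρ init (toℕ i ▸ g))

  -- The hybrid ∃f keeps the history that the one of CTL* discards. Translated formulas never look
  -- back, so gluing the prefix of `ρ` in front of a new path does not affect them.
  toHybrid-ok : ∀ φ {n} (K : Kripke k n) ρ → Initial K ρ → ∀ g i →
                satH K ρ g i (toHybrid φ) ⇔ satL K φ (st ρ i) (after (st ρ) i)
  toHybrid-ok ⊤c       K ρ init g i = ⇔.refl
  toHybrid-ok (atom p) K ρ init g i = ⇔.refl
  toHybrid-ok (¬c φ)   K ρ init g i = ¬-cong (toHybrid-ok φ K ρ init g i)
  toHybrid-ok (φ ∧c ψ) K ρ init g i = ⇔.trans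
    (¬¬-∧ (satH? (toHybrid-wf φ) K ρ init g i) (satH? (toHybrid-wf ψ) K ρ init g i))
    (toHybrid-ok φ K ρ init g i ×-⇔ toHybrid-ok ψ K ρ init g i)
  toHybrid-ok (Xc φ)   K ρ init g i = next⇔ (st ρ) (toHybrid-ok φ K ρ init g) i
  toHybrid-ok (φ Uc ψ) K ρ init g i =
    until⇔ (st ρ) (toHybrid-ok φ K ρ init g) (toHybrid-ok ψ K ρ init g) i
  toHybrid-ok (∃fc φ)  K ρ init g i = mk⇔ fwd bwd
    where
    fwd : satH K ρ g i (∃fh (toHybrid φ)) → satL K (∃fc φ) (st ρ i) (after (st ρ) i)
    fwd (ρ′ , init′ , ag , i′ , eq , h) = after (st ρ′) i′ ,
      subst (λ s → Path K s (after (st ρ′) i′)) here′ (path-after K ρ′ i′) ,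
      subst (λ s → satL K φ s (after (st ρ′) i′)) here′ (to (toHybrid-ok φ K ρ′ init′ g i′) h)
      where
      here′ : st ρ′ i′ ≡ st ρ i
      here′ = sym (ag i i′ (sym eq) ≤-refl)
    bwd : satL K (∃fc φ) (st ρ i) (after (st ρ) i) → satH K ρ g i (∃fh (toHybrid φ))
    bwd (v , p , h) = E.trace , trans E.start init , E.agree , E.pos , E.toℕ-pos ,
      from (toHybrid-ok φ K E.trace (trans E.start init) g E.pos)
        (subst₂ (satL K φ) (sym E.≡here) (sym E.≡after) h)
      where module E = Extension (extend K ρ i v p)

theorem30 : (k : ℕ) →
    ((φ : HForm k) → WellFormedSentence φ →
    Σ[ ψ ∈ CForm k ] SameFiniteModels φ ψ)
    × ((ψ : CForm k) →
    Σ[ φ ∈ HForm k ] WellFormedSentence φ × SameFiniteModels φ ψ)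
theorem30 k =
  (λ φ (_ , w) → let open FromHybrid {φ = φ} (rec-H w) in
    fromHybrid , λ (mkFinKripke _ K) →
      Π-⇔ λ ρ → Π-⇔ λ init → fromHybrid-ok K ρ init) ,
  (λ ψ → toHybrid ψ , (toHybrid-sentence ψ , toHybrid-wf ψ) , λ (mkFinKripke _ K) →
      Π-⇔ λ ρ → Π-⇔ λ init → ⇔.trans (toHybrid-ok ψ K ρ init (const 0) zero)
        (⇔.sym (satC⇔satL K ψ ρ zero)))
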